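{- For every $\varepsilon>0$ there is a constant $c=c(\varepsilon)>0$ such that the following holds. Let $G$ be a graph with average degree $d$ and fewer than $(1-\varepsilon)d^3/6$ triangles. Then $\mathrm{sp}(G)\ge c\,d^2$.
   Context: All graphs are finite and simple. $\mathrm{mc}(G)$ denotes the maximum number of edges crossing a partition of $V(G)$ into two parts, and the surplus of $G$ is $\mathrm{sp}(G)=\mathrm{mc}(G)-e(G)/2$, where $e(G)$ is the number of edges. A triangle is a copy of $K_3$ in $G$. -}

module Defs where

open import Data.Nat using (ℕ; NonZero; zero; suc; _+_; _*_; _<ᵇ_; _⊔_)
open import Data.Bool using (Bool; true; false; _∧_; _xor_; if_then_else_)
open import Data.Fin using (Fin; toℕ)
open import Data.List using (List; []; _∷_; map; foldr; concatMap; allFin)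
open import Data.Nat.ListAction using (sum)
open import Data.Vec using (Vec; lookup) renaming ([] to []ᵥ; _∷_ to _∷ᵥ_)
open import Data.Integer using (+_)
open import Data.Rational using (ℚ; _/_; _-_)
open import Relation.Binary.PropositionalEquality using (_≡_)

record Graph (n : ℕ) : Set where
  field
    adj    : Fin n → Fin n → Bool
    sym    : ∀ i j → adj i j ≡ adj j i
    irrefl : ∀ i → adj i i ≡ false
open Graph public

private
  ind : Bool → ℕ
  ind true  = 1
  ind false = 0

  Σ[_] : (n : ℕ) → (Fin n → ℕ) → ℕ
  Σ[ n ] f = sum (map f (allFin n))

edges : ∀ {n} → Graph n → ℕ
edges {n} G = Σ[ n ] λ i → Σ[ n ] λ j →
  ind ((toℕ i <ᵇ toℕ j) ∧ adj G i j)

triangles : ∀ {n} → Graph n → ℕ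
triangles {n} G = Σ[ n ] λ i → Σ[ n ] λ j → Σ[ n ] λ k →
  ind ((toℕ i <ᵇ toℕ j) ∧ (toℕ j <ᵇ toℕ k) ∧
       adj G i j ∧ adj G j k ∧ adj G i k)

-- a partition of V(G) into two parts, given by a side for each vertex
Partition : ℕ → Set
Partition n = Vec Bool n

cut : ∀ {n} → Graph n → Partition n → ℕ
cut {n} G S = Σ[ n ] λ i → Σ[ n ] λ j →
  ind ((toℕ i <ᵇ toℕ j) ∧ adj G i j ∧ (lookup S i xor lookup S j))

allPartitions : (n : ℕ) → List (Partition n)
allPartitions zero    = []ᵥ ∷ []
allPartitions (suc n) =
  concatMap (λ v → (true ∷ᵥ v) ∷ (false ∷ᵥ v) ∷ []) (allPartitions n)

mc : ∀ {n} → Graph n → ℕ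
mc {n} G = foldr _⊔_ 0 (map (cut G) (allPartitions n))

sp : ∀ {n} → Graph n → ℚ
sp G = (+ mc G / 1) - (+ edges G / 2)

avgDeg : ∀ {n} → .{{_ : NonZero n}} → Graph n → ℚ
avgDeg {n} G = + (2 * edges G) / n

{-# OPTIONS --safe #-}

-- Rounding shows that 4 sp(G) ≥ − xᵀAx for every x ∈ [−1,1]^V, so a random x with small
-- E xᵀAx suffices.  For independent uniform vertices s, t the vector 1_{N(u)}(s) − 1_{N(u)}(t)
-- has covariance proportional to n·codeg(u,v) − deg(u)·deg(v); summed over the edges the
-- codegrees give 6 times the number of triangles, while the degree products give at least
-- about n d³.  One pair yields only a surplus of order d³/n, so about n/d independent pairs
-- are superposed, each vertex mostly hearing the first pair that meets its neighbourhood.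
-- This keeps x in the cube and multiplies the covariances by factors close to 1.  Vertices
-- of degree far above d are damped by w(u) = 4d/(4d + ε deg(u)); by AM-GM on the edges this
-- costs only a factor 1 − ε/2 in the main term.

module Submission where

open import Defs
open import Data.Nat using (ℕ; NonZero)
open import Data.Integer using (+_)
open import Data.Rational using (ℚ; _/_; _-_; _*_; _<_; _≤_; 0ℚ; 1ℚ)
open import Data.Product using (Σ; _×_)
open import Data.Rational using (½; -_; _+_; mkℚ; toℚᵘ; 1/_; *≤*; ≢-nonZero; positive; nonNegative)
open import Data.Rational.Properties
open import Data.Rational.Solver using (module +-*-Solver)
open +-*-Solver using (solve; _:=_; _:+_; _:*_; _:-_; :-_; con)
import Data.Rational.Unnormalised as ℚᵘ
import Data.Rational.Unnormalised.Properties as ℚᵘP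
open import Data.Nat as ℕ using (zero; suc)
import Data.Nat.Properties as ℕP
open import Data.Nat.ListAction using (sum)
open import Data.Integer as ℤ using ()
import Data.Integer.Properties as ℤP
open import Data.Bool using (Bool; true; false; _xor_)
open import Data.Bool.Properties using (T-≡; xor-comm)
open import Data.Fin using (Fin; zero; suc; toℕ)
import Data.Fin.Properties as FinP
open import Data.List as List using (List; []; _∷_; allFin; foldr)
open import Data.List.Properties using (map-tabulate)
open import Data.List.Membership.Propositional using (_∈_)
open import Data.List.Membership.Propositional.Properties using (∈-allFin; ∈-map⁺; ∈-concatMap⁺)
open import Data.List.Relation.Unary.Any as Any using (here; there)
open import Data.Vec as Vec using (lookup)
open import Data.Vec.Properties using (lookup∘tabulate)
open import Data.Product using (_,_; proj₁; proj₂)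
open import Data.Sum using (_⊎_; inj₁; inj₂)
open import Function using (id; Equivalence)
open import Algebra.Bundles using (CommutativeRing)
open import Algebra.Properties.Semiring.Sum (CommutativeRing.semiring +-*-commutativeRing) as Sum using ()
open import Relation.Binary.Definitions using (tri<; tri≈; tri>)
open import Relation.Nullary using (¬_; yes; no; contradiction)
open import Relation.Binary.PropositionalEquality
  using (_≡_; refl; trans; cong; cong₂; subst; subst₂; module ≡-Reasoning)
  renaming (sym to ≡-sym)

-- The triangle hypothesis leaves a margin of ε, and every loss has to fit into it: damping costs
-- ε/2, the overlap of the pairs ε/4, and ε/4 survives. The overlap limits the number of pairs. A
-- pair meets N(u) with probability up to 2 deg(u)/n, so a vertex of very large degree would soon be
-- saturated. The damped degree f(u) = w(u) deg(u) never exceeds 4d/ε, which makes about ε² n/(64 d)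
-- pairs affordable at every vertex simultaneously. The shape of w is dictated by the edge
-- inequality: d/f(u) = d/deg(u) + ε/4, so the reciprocals produced by AM-GM can be summed over the
-- edges at each vertex. A pair enters through a difference because swapping s and t then reverses
-- its sign. Contributions of different pairs are therefore uncorrelated, and an edge retains only
-- (number of pairs) × (survival factor) × (covariance of one pair). The expectation is taken one
-- pair at a time, by recursion on the number of pairs, so that only averages over n² ordered pairs
-- ever occur.

2ℚ 3ℚ 4ℚ : ℚ
2ℚ = + 2 / 1
3ℚ = + 3 / 1
4ℚ = + 4 / 1

-- Natural numbers inside the rationals, and rules for inequalities

abstract
  fromℕ : ℕ → ℚ
  fromℕ m = + m / 1

  fromℕ-def : ∀ m → fromℕ m ≡ + m / 1
  fromℕ-def m = refl

  fromℕ-zero : fromℕ 0 ≡ 0ℚ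
  fromℕ-zero = refl

  fromℕ-one : fromℕ 1 ≡ 1ℚ
  fromℕ-one = refl

  /-*-cancel : ∀ m n .{{_ : NonZero n}} → (+ m / n) * fromℕ n ≡ fromℕ m
  /-*-cancel m n@(suc _) = toℚᵘ-injective (begin
    toℚᵘ ((+ m / n) * fromℕ n)                  ≈⟨ toℚᵘ-homo-* (+ m / n) (fromℕ n) ⟩
    toℚᵘ (+ m / n) ℚᵘ.* toℚᵘ (fromℕ n)          ≈⟨ ℚᵘP.*-cong (toℚᵘ-fromℚᵘ (+ m ℚᵘ./ n)) (toℚᵘ-fromℚᵘ (+ n ℚᵘ./ 1)) ⟩
    (+ m ℚᵘ./ n) ℚᵘ.* (+ n ℚᵘ./ 1)              ≈⟨ ℚᵘ.*≡* (trans (ℤP.*-identityʳ (+ m ℤ.* + n)) (cong (λ k → + m ℤ.* + k) (≡-sym (ℕP.*-identityʳ n)))) ⟩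
    + m ℚᵘ./ 1                                  ≈⟨ toℚᵘ-fromℚᵘ (+ m ℚᵘ./ 1) ⟨
    toℚᵘ (fromℕ m)                              ∎)
    where open ℚᵘP.≃-Reasoning

  fromℕ-+ : ∀ m n → fromℕ (m ℕ.+ n) ≡ fromℕ m + fromℕ n
  fromℕ-+ m n = toℚᵘ-injective (begin
    toℚᵘ (fromℕ (m ℕ.+ n))                ≈⟨ toℚᵘ-fromℚᵘ (+ (m ℕ.+ n) ℚᵘ./ 1) ⟩
    + (m ℕ.+ n) ℚᵘ./ 1                    ≈⟨ ℚᵘ.*≡* (cong (ℤ._* + 1) (≡-sym (cong₂ ℤ._+_ (ℤP.*-identityʳ (+ m)) (ℤP.*-identityʳ (+ n))))) ⟩
    (+ m ℚᵘ./ 1) ℚᵘ.+ (+ n ℚᵘ./ 1)        ≈⟨ ℚᵘP.+-cong (toℚᵘ-fromℚᵘ (+ m ℚᵘ./ 1)) (toℚᵘ-fromℚᵘ (+ n ℚᵘ./ 1)) ⟨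
    toℚᵘ (fromℕ m) ℚᵘ.+ toℚᵘ (fromℕ n)    ≈⟨ toℚᵘ-homo-+ (fromℕ m) (fromℕ n) ⟨
    toℚᵘ (fromℕ m + fromℕ n)              ∎)
    where open ℚᵘP.≃-Reasoning

  fromℕ-nonNeg : ∀ m → 0ℚ ≤ fromℕ m
  fromℕ-nonNeg m = nonNegative⁻¹ (fromℕ m) {{normalize-nonNeg m 1}}

  fromℕ-pos : ∀ n .{{_ : NonZero n}} → 0ℚ < fromℕ n
  fromℕ-pos n = positive⁻¹ (fromℕ n) {{normalize-pos n 1}}

  fromℕ-suc : ∀ n → fromℕ (suc n) ≡ 1ℚ + fromℕ n
  fromℕ-suc n = fromℕ-+ 1 n

fromℕ-mono : ∀ {m n} → m ℕ.≤ n → fromℕ m ≤ fromℕ n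
fromℕ-mono {m} {n} m≤n = begin
  fromℕ m                       ≡⟨ +-identityʳ (fromℕ m) ⟨
  fromℕ m + 0ℚ                  ≤⟨ +-monoʳ-≤ (fromℕ m) (fromℕ-nonNeg (n ℕ.∸ m)) ⟩
  fromℕ m + fromℕ (n ℕ.∸ m)     ≡⟨ fromℕ-+ m (n ℕ.∸ m) ⟨
  fromℕ (m ℕ.+ (n ℕ.∸ m))       ≡⟨ cong fromℕ (ℕP.m+[n∸m]≡n m≤n) ⟩
  fromℕ n                       ∎
  where open ≤-Reasoning

0≤-by : ∀ {p q} → q ≡ p → 0ℚ ≤ p → 0ℚ ≤ q
0≤-by refl 0≤p = 0≤p

-- Most inequalities below are proved by a certificate of this kind: a ring identity turns the
-- difference of the two sides into an expression that is visibly nonnegative.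
≤-by-diff : ∀ {p q r} → q - p ≡ r → 0ℚ ≤ r → p ≤ q
≤-by-diff {p} {q} refl 0≤r = begin
  p              ≡⟨ +-identityʳ p ⟨
  p + 0ℚ         ≤⟨ +-monoʳ-≤ p 0≤r ⟩
  p + (q - p)    ≡⟨ solve 2 (λ p q → p :+ (q :- p) := q) refl p q ⟩
  q              ∎
  where open ≤-Reasoning

0≤-diff : ∀ {p q} → p ≤ q → 0ℚ ≤ q - p
0≤-diff {p} {q} p≤q = begin
  0ℚ       ≡⟨ +-inverseʳ p ⟨
  p - p    ≤⟨ +-monoˡ-≤ (- p) p≤q ⟩
  q - p    ∎
  where open ≤-Reasoning

0≤-+ : ∀ {p q} → 0ℚ ≤ p → 0ℚ ≤ q → 0ℚ ≤ p + q
0≤-+ = +-mono-≤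

0≤-* : ∀ {p q} → 0ℚ ≤ p → 0ℚ ≤ q → 0ℚ ≤ p * q
0≤-* {p} {q} 0≤p 0≤q =
  nonNegative⁻¹ _ {{nonNeg*nonNeg⇒nonNeg p {{nonNegative 0≤p}} q {{nonNegative 0≤q}}}}

0<-* : ∀ {p q} → 0ℚ < p → 0ℚ < q → 0ℚ < p * q
0<-* {p} {q} 0<p 0<q = positive⁻¹ _ {{pos*pos⇒pos p {{positive 0<p}} q {{positive 0<q}}}}

0≤-square : ∀ p → 0ℚ ≤ p * p
0≤-square p with ≤-total 0ℚ p
... | inj₁ 0≤p = 0≤-* 0≤p 0≤p
... | inj₂ p≤0 = 0≤-by (solve 1 (λ p → p :* p := (con 0ℚ :- p) :* (con 0ℚ :- p)) refl p)
                       (0≤-* (0≤-diff p≤0) (0≤-diff p≤0))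

*-monoˡ-≤ : ∀ {r p q} → 0ℚ ≤ r → p ≤ q → r * p ≤ r * q
*-monoˡ-≤ {r} 0≤r = *-monoˡ-≤-nonNeg r {{nonNegative 0≤r}}

0≤-cancel : ∀ {r p} → 0ℚ < r → 0ℚ ≤ r * p → 0ℚ ≤ p
0≤-cancel {r} {p} 0<r 0≤rp =
  *-cancelˡ-≤-pos r {{positive 0<r}} (subst (_≤ r * p) (≡-sym (*-zeroʳ r)) 0≤rp)

abstract
  inv : ℚ → ℚ
  inv p with p ≟ 0ℚ
  ... | yes _   = 0ℚ
  ... | no  p≢0 = (1/ p) {{≢-nonZero p≢0}}

  *-inv : ∀ {p} → 0ℚ < p → p * inv p ≡ 1ℚ
  *-inv {p} 0<p with p ≟ 0ℚ
  ... | yes p≡0 = contradiction (≡-sym p≡0) (<⇒≢ 0<p)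
  ... | no  p≢0 = *-inverseʳ p {{≢-nonZero p≢0}}

  inv-pos : ∀ {p} → 0ℚ < p → 0ℚ < inv p
  inv-pos {p} 0<p with p ≟ 0ℚ
  ... | yes p≡0 = contradiction (≡-sym p≡0) (<⇒≢ 0<p)
  ... | no  p≢0 = positive⁻¹ _ {{1/pos⇒pos p {{positive 0<p}}}}

0≤⇒≡0⊎0< : ∀ {p} → 0ℚ ≤ p → (p ≡ 0ℚ) ⊎ (0ℚ < p)
0≤⇒≡0⊎0< {p} 0≤p with p ≟ 0ℚ
... | yes p≡0 = inj₁ p≡0
... | no  p≢0 = inj₂ (positive⁻¹ p {{nonNeg∧nonZero⇒pos p {{nonNegative 0≤p}} {{≢-nonZero p≢0}}}})

-- Finite sums

abstract
  ∑ : ∀ {n} → (Fin n → ℚ) → ℚ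
  ∑ = Sum.sum

  ∑-zero : (f : Fin 0 → ℚ) → ∑ f ≡ 0ℚ
  ∑-zero f = refl

  ∑-suc : ∀ {n} (f : Fin (suc n) → ℚ) → ∑ f ≡ f zero + ∑ (λ i → f (suc i))
  ∑-suc f = refl

  ∑-cong : ∀ {n} {f g : Fin n → ℚ} → (∀ i → f i ≡ g i) → ∑ f ≡ ∑ g
  ∑-cong = Sum.sum-cong-≗

  ∑-+ : ∀ {n} (f g : Fin n → ℚ) → ∑ (λ i → f i + g i) ≡ ∑ f + ∑ g
  ∑-+ = Sum.∑-distrib-+

  ∑-comm : ∀ {m n} (f : Fin m → Fin n → ℚ) → ∑ (λ i → ∑ (f i)) ≡ ∑ (λ j → ∑ (λ i → f i j))
  ∑-comm = Sum.∑-comm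

  ∑-*ˡ : ∀ {n} c (f : Fin n → ℚ) → ∑ (λ i → c * f i) ≡ c * ∑ f
  ∑-*ˡ c f = ≡-sym (Sum.*-distribˡ-sum c f)

  ∑-mono : ∀ {n} {f g : Fin n → ℚ} → (∀ i → f i ≤ g i) → ∑ f ≤ ∑ g
  ∑-mono {zero}  f≤g = ≤-refl
  ∑-mono {suc n} f≤g = +-mono-≤ (f≤g zero) (∑-mono (λ i → f≤g (suc i)))

  ∑-const : ∀ n c → ∑ {n} (λ _ → c) ≡ fromℕ n * c
  ∑-const zero    c = trans (≡-sym (*-zeroˡ c)) (cong (_* c) (≡-sym fromℕ-zero))
  ∑-const (suc n) c = begin
    c + ∑ {n} (λ _ → c)     ≡⟨ cong (λ s → c + s) (∑-const n c) ⟩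
    c + fromℕ n * c         ≡⟨ solve 2 (λ c m → c :+ m :* c := (con 1ℚ :+ m) :* c) refl c (fromℕ n) ⟩
    (1ℚ + fromℕ n) * c      ≡⟨ cong (_* c) (fromℕ-suc n) ⟨
    fromℕ (suc n) * c       ∎
    where open ≡-Reasoning

∑-nonNeg : ∀ {n} {f : Fin n → ℚ} → (∀ i → 0ℚ ≤ f i) → 0ℚ ≤ ∑ f
∑-nonNeg {n} {f} 0≤f = begin
  0ℚ                  ≡⟨ *-zeroʳ (fromℕ n) ⟨
  fromℕ n * 0ℚ        ≡⟨ ∑-const n 0ℚ ⟨
  ∑ {n} (λ _ → 0ℚ)    ≤⟨ ∑-mono 0≤f ⟩
  ∑ f                 ∎
  where open ≤-Reasoning

∑∑ : ∀ {m n} → (Fin m → Fin n → ℚ) → ℚ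
∑∑ f = ∑ λ i → ∑ (f i)

∑∑-cong : ∀ {m n} {f g : Fin m → Fin n → ℚ} → (∀ i j → f i j ≡ g i j) → ∑∑ f ≡ ∑∑ g
∑∑-cong f≡g = ∑-cong λ i → ∑-cong (f≡g i)

∑∑-nonNeg : ∀ {m n} {f : Fin m → Fin n → ℚ} → (∀ i j → 0ℚ ≤ f i j) → 0ℚ ≤ ∑∑ f
∑∑-nonNeg 0≤f = ∑-nonNeg λ i → ∑-nonNeg (0≤f i)

∑∑-mono : ∀ {m n} {f g : Fin m → Fin n → ℚ} → (∀ i j → f i j ≤ g i j) → ∑∑ f ≤ ∑∑ g
∑∑-mono f≤g = ∑-mono λ i → ∑-mono (f≤g i)

∑∑-+ : ∀ {m n} (f g : Fin m → Fin n → ℚ) → ∑∑ (λ i j → f i j + g i j) ≡ ∑∑ f + ∑∑ g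
∑∑-+ f g = trans (∑-cong λ i → ∑-+ (f i) (g i)) (∑-+ _ _)

∑∑-*ˡ : ∀ {m n} c (f : Fin m → Fin n → ℚ) → ∑∑ (λ i j → c * f i j) ≡ c * ∑∑ f
∑∑-*ˡ c f = trans (∑-cong λ i → ∑-*ˡ c (f i)) (∑-*ˡ c _)

∑∑-linear : ∀ {m n} a b (f g : Fin m → Fin n → ℚ) →
            ∑∑ (λ i j → a * f i j + b * g i j) ≡ a * ∑∑ f + b * ∑∑ g
∑∑-linear a b f g = trans (∑∑-+ _ _) (cong₂ _+_ (∑∑-*ˡ a f) (∑∑-*ˡ b g))

∑∑-const : ∀ n c → ∑∑ {n} {n} (λ _ _ → c) ≡ fromℕ n * (fromℕ n * c)
∑∑-const n c = trans (∑-cong {n} λ _ → ∑-const n c) (∑-const n _)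

∑∑-product : ∀ {m n} (f : Fin m → ℚ) (g : Fin n → ℚ) → ∑∑ (λ i j → f i * g j) ≡ ∑ f * ∑ g
∑∑-product f g = begin
  ∑∑ (λ i j → f i * g j)    ≡⟨ ∑-cong (λ i → trans (∑-*ˡ (f i) g) (*-comm (f i) (∑ g))) ⟩
  ∑ (λ i → ∑ g * f i)       ≡⟨ ∑-*ˡ (∑ g) f ⟩
  ∑ g * ∑ f                 ≡⟨ *-comm (∑ g) (∑ f) ⟩
  ∑ f * ∑ g                 ∎
  where open ≡-Reasoning

∑∑-antisym : ∀ {n} (f : Fin n → Fin n → ℚ) → (∀ i j → f i j + f j i ≡ 0ℚ) → ∑∑ f ≡ 0ℚ
∑∑-antisym {n} f anti = begin
  ∑∑ f                     ≡⟨ solve 1 (λ s → s := con ½ :* (s :+ s)) refl (∑∑ f) ⟩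
  ½ * (∑∑ f + ∑∑ f)        ≡⟨ cong (λ s → ½ * (∑∑ f + s)) (∑-comm f) ⟩
  ½ * (∑∑ f + ∑∑ (λ i j → f j i))   ≡⟨ cong (½ *_) (∑∑-+ f _) ⟨
  ½ * ∑∑ (λ i j → f i j + f j i)   ≡⟨ cong (½ *_) (∑∑-cong anti) ⟩
  ½ * ∑∑ {n} {n} (λ i j → 0ℚ)      ≡⟨ cong (½ *_) (∑∑-const n 0ℚ) ⟩
  ½ * (fromℕ n * (fromℕ n * 0ℚ))   ≡⟨ solve 1 (λ m → con ½ :* (m :* (m :* con 0ℚ)) := con 0ℚ) refl (fromℕ n) ⟩
  0ℚ                       ∎
  where open ≡-Reasoning

-- Quadratic forms on the cube

quad : ∀ {n} → (Fin n → Fin n → ℚ) → (Fin n → ℚ) → ℚ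
quad A x = ∑∑ λ u v → A u v * (x u * x v)

InBox : ∀ {n} → (Fin n → ℚ) → Set
InBox x = ∀ u → (- 1ℚ ≤ x u) × (x u ≤ 1ℚ)

sign : Bool → ℚ
sign true  = 1ℚ
sign false = - 1ℚ

_[_≔_] : ∀ {n} {a} {X : Set a} → (Fin n → X) → Fin n → X → Fin n → X
(x [ i ≔ a ]) u with u FinP.≟ i
... | yes _ = a
... | no  _ = x u

-- The weights are the probabilities of rounding `x i` to 1 and to - 1 with mean `x i`. Off the
-- diagonal an entry is affine in `x i`, so this averaging is exact; the one entry with `x i`
-- squared is removed by `A-diag`.
quad-interpolate : ∀ {n} (A : Fin n → Fin n → ℚ) → (∀ u → A u u ≡ 0ℚ) → ∀ x i →
  quad A x ≡ (½ * (1ℚ + x i)) * quad A (x [ i ≔ 1ℚ ]) + (½ * (1ℚ - x i)) * quad A (x [ i ≔ - 1ℚ ])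
quad-interpolate A A-diag x i = trans (∑∑-cong pointwise) (∑∑-linear (½ * (1ℚ + x i)) (½ * (1ℚ - x i))
    (λ u v → A u v * ((x [ i ≔ 1ℚ ]) u * (x [ i ≔ 1ℚ ]) v))
    (λ u v → A u v * ((x [ i ≔ - 1ℚ ]) u * (x [ i ≔ - 1ℚ ]) v)))
  where
  pointwise : ∀ u v → A u v * (x u * x v) ≡
    (½ * (1ℚ + x i)) * (A u v * ((x [ i ≔ 1ℚ ]) u * (x [ i ≔ 1ℚ ]) v)) +
    (½ * (1ℚ - x i)) * (A u v * ((x [ i ≔ - 1ℚ ]) u * (x [ i ≔ - 1ℚ ]) v))
  pointwise u v with u FinP.≟ i | v FinP.≟ i
  ... | yes refl | yes refl rewrite A-diag i =
    solve 1 (λ p → con 0ℚ :* (p :* p) :=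
      (con ½ :* (con 1ℚ :+ p)) :* (con 0ℚ :* (con 1ℚ :* con 1ℚ)) :+
      (con ½ :* (con 1ℚ :- p)) :* (con 0ℚ :* (con (- 1ℚ) :* con (- 1ℚ)))) refl (x i)
  ... | yes refl | no _ =
    solve 3 (λ a p q → a :* (p :* q) :=
      (con ½ :* (con 1ℚ :+ p)) :* (a :* (con 1ℚ :* q)) :+
      (con ½ :* (con 1ℚ :- p)) :* (a :* (con (- 1ℚ) :* q))) refl (A i v) (x i) (x v)
  ... | no _ | yes refl =
    solve 3 (λ a p q → a :* (q :* p) :=
      (con ½ :* (con 1ℚ :+ p)) :* (a :* (q :* con 1ℚ)) :+
      (con ½ :* (con 1ℚ :- p)) :* (a :* (q :* con (- 1ℚ)))) refl (A u i) (x i) (x u)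
  ... | no _ | no _ =
    solve 3 (λ a p q → a :* q :=
      (con ½ :* (con 1ℚ :+ p)) :* (a :* q) :+
      (con ½ :* (con 1ℚ :- p)) :* (a :* q)) refl (A u v) (x i) (x u * x v)

-- A quadratic form with zero diagonal is affine in each coordinate, so on the cube it is
-- minimised at a vertex.
cube-from-vertices : ∀ {n} (A : Fin n → Fin n → ℚ) → (∀ u → A u u ≡ 0ℚ) → ∀ B →
  (∀ (S : Fin n → Bool) → 0ℚ ≤ B + quad A (λ u → sign (S u))) → ∀ x → InBox x → 0ℚ ≤ B + quad A x
cube-from-vertices {n} A A-diag B vertices x box =
  go (allFin n) x (λ _ → true) box (λ u → inj₁ (∈-allFin u))
  where
  -- `is` holds the coordinates that may still be fractional; at every other coordinate `S` records
  -- the sign already chosen.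
  go : (is : List (Fin n)) → ∀ x (S : Fin n → Bool) → InBox x →
       (∀ u → (u ∈ is) ⊎ (x u ≡ sign (S u))) → 0ℚ ≤ B + quad A x
  go [] x S box rounded =
    0≤-by (cong (λ s → B + s) (∑∑-cong λ u v → cong (A u v *_) (cong₂ _*_ (at-vertex u) (at-vertex v))))
          (vertices S)
    where
    at-vertex : ∀ u → x u ≡ sign (S u)
    at-vertex u with rounded u
    ... | inj₂ eq = eq
  go (i ∷ is) x S box rounded = 0≤-by interpolate
    (0≤-+ (0≤-* (0≤-* (nonNegative⁻¹ ½) (0≤-by (+-comm 1ℚ (x i)) (0≤-diff (proj₁ (box i))))) (branch true))
          (0≤-* (0≤-* (nonNegative⁻¹ ½) (0≤-diff (proj₂ (box i)))) (branch false)))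
    where
    branch : ∀ b → 0ℚ ≤ B + quad A (x [ i ≔ sign b ])
    branch b = go is (x [ i ≔ sign b ]) (S [ i ≔ b ]) box′ rounded′
      where
      sign-in-box : ∀ b → (- 1ℚ ≤ sign b) × (sign b ≤ 1ℚ)
      sign-in-box true  = ≤ᵇ⇒≤ _ , ≤-refl
      sign-in-box false = ≤-refl , ≤ᵇ⇒≤ _

      box′ : InBox (x [ i ≔ sign b ])
      box′ u with u FinP.≟ i
      ... | yes _ = sign-in-box b
      ... | no  _ = box u

      rounded′ : ∀ u → (u ∈ is) ⊎ ((x [ i ≔ sign b ]) u ≡ sign ((S [ i ≔ b ]) u))
      rounded′ u with u FinP.≟ i | rounded u
      ... | yes _  | _                   = inj₂ refl
      ... | no u≢i | inj₁ (here u≡i)     = contradiction u≡i u≢i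
      ... | no _   | inj₁ (there u∈is)   = inj₁ u∈is
      ... | no _   | inj₂ eq             = inj₂ eq

    interpolate : B + quad A x ≡
      (½ * (1ℚ + x i)) * (B + quad A (x [ i ≔ 1ℚ ])) + (½ * (1ℚ - x i)) * (B + quad A (x [ i ≔ - 1ℚ ]))
    interpolate = trans (cong (λ s → B + s) (quad-interpolate A A-diag x i))
      (solve 4 (λ b p q r →
          b :+ ((con ½ :* (con 1ℚ :+ p)) :* q :+ (con ½ :* (con 1ℚ :- p)) :* r) :=
          (con ½ :* (con 1ℚ :+ p)) :* (b :+ q) :+ (con ½ :* (con 1ℚ :- p)) :* (b :+ r))
        refl B (x i) _ _)

-- Superposition of random pairs

module PairAverage (m : ℕ) (r : ℚ) (0≤r : 0ℚ ≤ r) (r-inverse : r * (fromℕ m * fromℕ m) ≡ 1ℚ) where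

  𝔼 : (Fin m → Fin m → ℚ) → ℚ
  𝔼 f = r * ∑∑ f

  𝔼-cong : ∀ {f g : Fin m → Fin m → ℚ} → (∀ s t → f s t ≡ g s t) → 𝔼 f ≡ 𝔼 g
  𝔼-cong f≡g = cong (r *_) (∑∑-cong f≡g)

  𝔼-nonNeg : ∀ {f : Fin m → Fin m → ℚ} → (∀ s t → 0ℚ ≤ f s t) → 0ℚ ≤ 𝔼 f
  𝔼-nonNeg 0≤f = 0≤-* 0≤r (∑∑-nonNeg 0≤f)

  𝔼-mono : ∀ {f g : Fin m → Fin m → ℚ} → (∀ s t → f s t ≤ g s t) → 𝔼 f ≤ 𝔼 g
  𝔼-mono f≤g = *-monoˡ-≤ 0≤r (∑∑-mono f≤g)

  𝔼-const : ∀ c → 𝔼 (λ _ _ → c) ≡ c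
  𝔼-const c = begin
    r * ∑∑ {m} {m} (λ _ _ → c)    ≡⟨ cong (r *_) (∑∑-const m c) ⟩
    r * (M * (M * c))             ≡⟨ solve 3 (λ r m c → r :* (m :* (m :* c)) := (r :* (m :* m)) :* c) refl r M c ⟩
    (r * (M * M)) * c             ≡⟨ cong (_* c) r-inverse ⟩
    1ℚ * c                        ≡⟨ *-identityˡ c ⟩
    c                             ∎
    where
    open ≡-Reasoning
    M = fromℕ m

  𝔼-+ : ∀ (f g : Fin m → Fin m → ℚ) → 𝔼 (λ s t → f s t + g s t) ≡ 𝔼 f + 𝔼 g
  𝔼-+ f g = trans (cong (r *_) (∑∑-+ f g)) (*-distribˡ-+ r (∑∑ f) (∑∑ g))

  𝔼-*ˡ : ∀ c (f : Fin m → Fin m → ℚ) → 𝔼 (λ s t → c * f s t) ≡ c * 𝔼 f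
  𝔼-*ˡ c f = trans (cong (r *_) (∑∑-*ˡ c f))
    (solve 3 (λ r c s → r :* (c :* s) := c :* (r :* s)) refl r c (∑∑ f))

  𝔼-∑ : ∀ {n} (f : Fin n → Fin m → Fin m → ℚ) → 𝔼 (λ s t → ∑ λ u → f u s t) ≡ ∑ λ u → 𝔼 (f u)
  𝔼-∑ f = begin
    r * ∑∑ (λ s t → ∑ λ u → f u s t)               ≡⟨ cong (r *_) (∑-cong λ s → ∑-comm λ t u → f u s t) ⟩
    r * ∑ (λ s → ∑ λ u → ∑ λ t → f u s t)          ≡⟨ cong (r *_) (∑-comm λ s u → ∑ λ t → f u s t) ⟩
    r * ∑ (λ u → ∑∑ (f u))                         ≡⟨ ∑-*ˡ r (λ u → ∑∑ (f u)) ⟨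
    ∑ (λ u → r * ∑∑ (f u))                         ∎
    where open ≡-Reasoning

  𝔼-∑∑ : ∀ {n} (f : Fin n → Fin n → Fin m → Fin m → ℚ) →
         𝔼 (λ s t → ∑∑ λ u v → f u v s t) ≡ ∑∑ λ u v → 𝔼 (f u v)
  𝔼-∑∑ f = trans (𝔼-∑ λ u s t → ∑ λ v → f u v s t) (∑-cong λ u → 𝔼-∑ (f u))

  𝔼-antisym : ∀ (f : Fin m → Fin m → ℚ) → (∀ s t → f s t + f t s ≡ 0ℚ) → 𝔼 f ≡ 0ℚ
  𝔼-antisym f anti = trans (cong (r *_) (∑∑-antisym f anti)) (*-zeroʳ r)

  𝔼-linear₄ : ∀ α β γ δ (a b c e : Fin m → Fin m → ℚ) →
    𝔼 (λ s t → (α * a s t + β * b s t) + (γ * c s t + δ * e s t)) ≡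
    (α * 𝔼 a + β * 𝔼 b) + (γ * 𝔼 c + δ * 𝔼 e)
  𝔼-linear₄ α β γ δ a b c e =
    trans (𝔼-+ (λ s t → α * a s t + β * b s t) (λ s t → γ * c s t + δ * e s t))
          (cong₂ _+_ (linear₂ α β a b) (linear₂ γ δ c e))
    where
    linear₂ : ∀ α β (a b : Fin m → Fin m → ℚ) →
      𝔼 (λ s t → α * a s t + β * b s t) ≡ α * 𝔼 a + β * 𝔼 b
    linear₂ α β a b = trans (𝔼-+ (λ s t → α * a s t) (λ s t → β * b s t))
                            (cong₂ _+_ (𝔼-*ˡ α a) (𝔼-*ˡ β b))

  -- `ξ u` is the signal that a pair sends to `u`, and `η u` the fraction of the remaining room at
  -- `u` that it consumes. Swapping the pair reverses the signal and preserves the fraction.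
  module Process {n : ℕ}
    (A : Fin n → Fin n → ℚ) (B : ℚ)
    (on-cube : ∀ x → InBox x → 0ℚ ≤ B + quad A x)
    (ξ η : Fin n → Fin m → Fin m → ℚ)
    (ξ-antisym : ∀ u s t → ξ u t s ≡ - ξ u s t)
    (η-sym : ∀ u s t → η u t s ≡ η u s t)
    (ξ≤η : ∀ u s t → ξ u s t ≤ η u s t)
    (-ξ≤η : ∀ u s t → - ξ u s t ≤ η u s t)
    (η≤1 : ∀ u s t → η u s t ≤ 1ℚ)
    where

    Q K : Fin n → Fin n → ℚ
    Q u v = 𝔼 λ s t → (1ℚ - η u s t) * (1ℚ - η v s t)
    K u v = 𝔼 λ s t → ξ u s t * ξ v s t

    -- Coefficients after `k` further pairs: `Qpow` is what survives of an old product `x u * x v`,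
    -- and `L` is what the room `z u * z v` will have earned. In `L (suc k)` the first pair either
    -- contributes `K`, to be shrunk by the `k` later pairs, or merely shrinks the room left for
    -- them.
    Qpow L : ℕ → Fin n → Fin n → ℚ
    Qpow zero    u v = 1ℚ
    Qpow (suc k) u v = Qpow k u v * Q u v
    L zero    u v = 0ℚ
    L (suc k) u v = Qpow k u v * K u v + L k u v * Q u v

    -- The expected value of `quad A` after `k` further pairs, started from the state `x`, `z`.
    -- Mixed products of `x` and `z` are absent because they average to zero.
    form : ℕ → (x z : Fin n → ℚ) → ℚ
    form k x z = ∑∑ λ u v → A u v * (Qpow k u v * (x u * x v) + L k u v * (z u * z v))

    -- z u is the room left at u: a further pair adds z u · ξ u to x u and shrinks both x u
    -- and z u by the factor 1 − η u, so that |x u| + z u ≤ 1 persists.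
    Admissible : (x z : Fin n → ℚ) → Set
    Admissible x z = ∀ u → (0ℚ ≤ z u) × (z u + x u ≤ 1ℚ) × (z u - x u ≤ 1ℚ)

    next-x next-z : (x z : Fin n → ℚ) → Fin m → Fin m → Fin n → ℚ
    next-x x z s t u = x u * (1ℚ - η u s t) + z u * ξ u s t
    next-z x z s t u = z u * (1ℚ - η u s t)

    0≤η : ∀ u s t → 0ℚ ≤ η u s t
    0≤η u s t = 0≤-by (solve 2 (λ h k → h := con ½ :* ((h :- k) :+ (h :- (:- k)))) refl (η u s t) (ξ u s t))
      (0≤-* {½} (nonNegative⁻¹ ½) (0≤-+ (0≤-diff (ξ≤η u s t)) (0≤-diff (-ξ≤η u s t))))

    -- The new value of |x| + z is at most a convex combination: weight 1 - η on the old |x| + z,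
    -- and weight η on z alone. Both are at most 1.
    next-admissible : ∀ x z → Admissible x z → ∀ s t → Admissible (next-x x z s t) (next-z x z s t)
    next-admissible x z adm s t u = 0≤-* 0≤z 0≤1-η , upper , lower
      where
      0≤z = proj₁ (adm u)
      0≤1-η = 0≤-diff (η≤1 u s t)
      0≤1-z-x = 0≤-diff (proj₁ (proj₂ (adm u)))
      0≤1-z+x = 0≤-diff (proj₂ (proj₂ (adm u)))
      0≤1-z : 0ℚ ≤ 1ℚ - z u
      0≤1-z = 0≤-by
        (solve 2 (λ z x → con 1ℚ :- z := con ½ :* ((con 1ℚ :- (z :+ x)) :+ (con 1ℚ :- (z :- x)))) refl (z u) (x u))
        (0≤-* {½} (nonNegative⁻¹ ½) (0≤-+ 0≤1-z-x 0≤1-z+x))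
      upper = ≤-by-diff
        (solve 4 (λ x z h k →
            con 1ℚ :- (z :* (con 1ℚ :- h) :+ (x :* (con 1ℚ :- h) :+ z :* k)) :=
            (con 1ℚ :- (z :+ x)) :* (con 1ℚ :- h) :+ (h :* (con 1ℚ :- z) :+ z :* (h :- k)))
          refl (x u) (z u) (η u s t) (ξ u s t))
        (0≤-+ (0≤-* 0≤1-z-x 0≤1-η) (0≤-+ (0≤-* (0≤η u s t) 0≤1-z) (0≤-* 0≤z (0≤-diff (ξ≤η u s t)))))
      lower = ≤-by-diff
        (solve 4 (λ x z h k →
            con 1ℚ :- (z :* (con 1ℚ :- h) :- (x :* (con 1ℚ :- h) :+ z :* k)) :=
            (con 1ℚ :- (z :- x)) :* (con 1ℚ :- h) :+ (h :* (con 1ℚ :- z) :+ z :* (h :- (:- k))))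
          refl (x u) (z u) (η u s t) (ξ u s t))
        (0≤-+ (0≤-* 0≤1-z+x 0≤1-η) (0≤-+ (0≤-* (0≤η u s t) 0≤1-z) (0≤-* 0≤z (0≤-diff (-ξ≤η u s t)))))

    admissible-box : ∀ x z → Admissible x z → InBox x
    admissible-box x z adm u =
      ≤-by-diff (solve 2 (λ x z → x :- con (- 1ℚ) := (con 1ℚ :- (z :- x)) :+ z) refl (x u) (z u))
                (0≤-+ (0≤-diff (proj₂ (proj₂ (adm u)))) (proj₁ (adm u))) ,
      ≤-by-diff (solve 2 (λ x z → con 1ℚ :- x := (con 1ℚ :- (z :+ x)) :+ z) refl (x u) (z u))
                (0≤-+ (0≤-diff (proj₁ (proj₂ (adm u)))) (proj₁ (adm u)))

    -- Swapping the two vertices of a pair changes the sign of ξ but not η, so the cross terms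
    -- between old and new contributions average out.
    𝔼-mixed : ∀ u v → 𝔼 (λ s t → (1ℚ - η u s t) * ξ v s t) ≡ 0ℚ
    𝔼-mixed u v = 𝔼-antisym _ λ s t →
      trans (cong₂ (λ h k → (1ℚ - η u s t) * ξ v s t + (1ℚ - h) * k) (η-sym u s t) (ξ-antisym v s t))
            (solve 2 (λ h k → (con 1ℚ :- h) :* k :+ (con 1ℚ :- h) :* (:- k) := con 0ℚ) refl (η u s t) (ξ v s t))

    𝔼-next : ∀ k x z u v →
      𝔼 (λ s t → A u v * (Qpow k u v * (next-x x z s t u * next-x x z s t v) +
                          L k u v * (next-z x z s t u * next-z x z s t v))) ≡
      A u v * (Qpow (suc k) u v * (x u * x v) + L (suc k) u v * (z u * z v))
    𝔼-next k x z u v = begin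
      𝔼 (λ s t → a * (p * (next-x x z s t u * next-x x z s t v) + l * (next-z x z s t u * next-z x z s t v)))
        ≡⟨ 𝔼-cong (λ s t → expand (η u s t) (η v s t) (ξ u s t) (ξ v s t)) ⟩
      𝔼 (λ s t → ((a * (p * (x u * x v) + l * (z u * z v))) * ((1ℚ - η u s t) * (1ℚ - η v s t)) +
                  (a * (p * (x u * z v))) * ((1ℚ - η u s t) * ξ v s t)) +
                 ((a * (p * (z u * x v))) * ((1ℚ - η v s t) * ξ u s t) +
                  (a * (p * (z u * z v))) * (ξ u s t * ξ v s t)))
        ≡⟨ 𝔼-linear₄ (a * (p * (x u * x v) + l * (z u * z v))) (a * (p * (x u * z v)))
                     (a * (p * (z u * x v))) (a * (p * (z u * z v)))
                     (λ s t → (1ℚ - η u s t) * (1ℚ - η v s t)) (λ s t → (1ℚ - η u s t) * ξ v s t)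
                     (λ s t → (1ℚ - η v s t) * ξ u s t) (λ s t → ξ u s t * ξ v s t) ⟩
      ((a * (p * (x u * x v) + l * (z u * z v))) * Q u v +
       (a * (p * (x u * z v))) * 𝔼 (λ s t → (1ℚ - η u s t) * ξ v s t)) +
      ((a * (p * (z u * x v))) * 𝔼 (λ s t → (1ℚ - η v s t) * ξ u s t) +
       (a * (p * (z u * z v))) * K u v)
        ≡⟨ cong₂ (λ e f → ((a * (p * (x u * x v) + l * (z u * z v))) * Q u v + (a * (p * (x u * z v))) * e) +
                          ((a * (p * (z u * x v))) * f + (a * (p * (z u * z v))) * K u v))
                 (𝔼-mixed u v) (𝔼-mixed v u) ⟩
      ((a * (p * (x u * x v) + l * (z u * z v))) * Q u v + (a * (p * (x u * z v))) * 0ℚ) +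
      ((a * (p * (z u * x v))) * 0ℚ + (a * (p * (z u * z v))) * K u v)
        ≡⟨ solve 9 (λ a p l xu xv zu zv q k →
             ((a :* (p :* (xu :* xv) :+ l :* (zu :* zv))) :* q :+ (a :* (p :* (xu :* zv))) :* con 0ℚ) :+
             ((a :* (p :* (zu :* xv))) :* con 0ℚ :+ (a :* (p :* (zu :* zv))) :* k) :=
             a :* ((p :* q) :* (xu :* xv) :+ (p :* k :+ l :* q) :* (zu :* zv)))
             refl a p l (x u) (x v) (z u) (z v) (Q u v) (K u v) ⟩
      a * (Qpow (suc k) u v * (x u * x v) + L (suc k) u v * (z u * z v)) ∎
      where
      open ≡-Reasoning
      a = A u v
      p = Qpow k u v
      l = L k u v
      expand : ∀ hu hv ku kv →
        a * (p * ((x u * (1ℚ - hu) + z u * ku) * (x v * (1ℚ - hv) + z v * kv)) +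
             l * ((z u * (1ℚ - hu)) * (z v * (1ℚ - hv)))) ≡
        ((a * (p * (x u * x v) + l * (z u * z v))) * ((1ℚ - hu) * (1ℚ - hv)) +
         (a * (p * (x u * z v))) * ((1ℚ - hu) * kv)) +
        ((a * (p * (z u * x v))) * ((1ℚ - hv) * ku) +
         (a * (p * (z u * z v))) * (ku * kv))
      expand = expand′ a p l (x u) (x v) (z u) (z v)
        where
        expand′ : ∀ a p l xu xv zu zv hu hv ku kv →
          a * (p * ((xu * (1ℚ - hu) + zu * ku) * (xv * (1ℚ - hv) + zv * kv)) +
               l * ((zu * (1ℚ - hu)) * (zv * (1ℚ - hv)))) ≡
          ((a * (p * (xu * xv) + l * (zu * zv))) * ((1ℚ - hu) * (1ℚ - hv)) +
           (a * (p * (xu * zv))) * ((1ℚ - hu) * kv)) +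
          ((a * (p * (zu * xv))) * ((1ℚ - hv) * ku) +
           (a * (p * (zu * zv))) * (ku * kv))
        expand′ a p l xu xv zu zv hu hv ku kv = trans
          (solve 9 (λ a p l xu xv zu zv gu gv →
             a :* (p :* (xu :* xv) :+ l :* ((zu :* gu) :* (zv :* gv))) :=
             a :* (p :* (xu :* xv)) :+ (a :* (l :* (zu :* zv))) :* (gu :* gv))
             refl a p l (xu * gu + zu * ku) (xv * gv + zv * kv) zu zv gu gv)
          (solve 11 (λ a p l xu xv zu zv gu gv ku kv →
             a :* (p :* ((xu :* gu :+ zu :* ku) :* (xv :* gv :+ zv :* kv))) :+ (a :* (l :* (zu :* zv))) :* (gu :* gv) :=
             ((a :* (p :* (xu :* xv) :+ l :* (zu :* zv))) :* (gu :* gv) :+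
              (a :* (p :* (xu :* zv))) :* (gu :* kv)) :+
             ((a :* (p :* (zu :* xv))) :* (gv :* ku) :+
              (a :* (p :* (zu :* zv))) :* (ku :* kv)))
             refl a p l xu xv zu zv gu gv ku kv)
          where
          gu = 1ℚ - hu
          gv = 1ℚ - hv

    -- Only the first of the pairs is averaged; the induction hypothesis covers every state to which
    -- it can lead. Nonnegativity passes to the average, and `𝔼-next` identifies that average with
    -- the form for one more pair.
    process : ∀ k x z → Admissible x z → 0ℚ ≤ B + form k x z
    process zero x z adm = 0≤-by
      (cong (λ s → B + s) (∑∑-cong λ u v → solve 3 (λ a p q → a :* (con 1ℚ :* p :+ con 0ℚ :* q) := a :* p)
                                               refl (A u v) (x u * x v) (z u * z v)))
      (on-cube x (admissible-box x z adm))
    process (suc k) x z adm = 0≤-by (≡-sym average)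
      (𝔼-nonNeg λ s t → process k (next-x x z s t) (next-z x z s t) (next-admissible x z adm s t))
      where
      open ≡-Reasoning
      average : 𝔼 (λ s t → B + form k (next-x x z s t) (next-z x z s t)) ≡ B + form (suc k) x z
      average = begin
        𝔼 (λ s t → B + form k (next-x x z s t) (next-z x z s t))
          ≡⟨ 𝔼-+ (λ _ _ → B) (λ s t → form k (next-x x z s t) (next-z x z s t)) ⟩
        𝔼 (λ _ _ → B) + 𝔼 (λ s t → form k (next-x x z s t) (next-z x z s t))
          ≡⟨ cong₂ _+_ (𝔼-const B) (trans (𝔼-∑∑ λ u v s t → _) (∑∑-cong (𝔼-next k x z))) ⟩
        B + form (suc k) x z ∎

    -- Each of the `suc k` pairs contributes `K` once, and each of the other `k` pairs multiplies
    -- that contribution by `Q`: an earlier pair by shrinking the room, a later one by shrinking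
    -- `x`. Since `x` and `z` shrink by the same factor, the order is immaterial.
    L-suc : ∀ k u v → L (suc k) u v ≡ fromℕ (suc k) * (Qpow k u v * K u v)
    L-suc zero    u v = trans
      (solve 2 (λ k q → con 1ℚ :* k :+ con 0ℚ :* q := con 1ℚ :* (con 1ℚ :* k)) refl (K u v) (Q u v))
      (cong (_* (1ℚ * K u v)) (≡-sym fromℕ-one))
    L-suc (suc k) u v = begin
      p * q * κ + L (suc k) u v * q     ≡⟨ cong (λ l → p * q * κ + l * q) (L-suc k u v) ⟩
      p * q * κ + c * (p * κ) * q       ≡⟨ solve 4 (λ p q κ c → p :* q :* κ :+ c :* (p :* κ) :* q := (con 1ℚ :+ c) :* (p :* q :* κ)) refl p q κ c ⟩
      (1ℚ + c) * (p * q * κ)            ≡⟨ cong (_* (p * q * κ)) (fromℕ-suc (suc k)) ⟨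
      fromℕ (suc (suc k)) * (p * q * κ) ∎
      where
      open ≡-Reasoning
      p = Qpow k u v
      q = Q u v
      κ = K u v
      c = fromℕ (suc k)

    -- The start is `x` = 0 with full room `z` = 1, so the pairs earn everything. The gain counts
    -- `suc k` pairs but the loss only `k`, as no pair shrinks its own contribution.
    process-bound : ∀ k → 0ℚ ≤ B + fromℕ (suc k) * ∑∑ (λ u v → A u v * (Qpow k u v * K u v))
    process-bound k = 0≤-by (cong (λ s → B + s) (≡-sym total))
      (process (suc k) (λ _ → 0ℚ) (λ _ → 1ℚ) (λ _ → ≤ᵇ⇒≤ _ , ≤-refl , ≤-refl))
      where
      open ≡-Reasoning
      total : form (suc k) (λ _ → 0ℚ) (λ _ → 1ℚ) ≡ fromℕ (suc k) * ∑∑ (λ u v → A u v * (Qpow k u v * K u v))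
      total = trans (∑∑-cong λ u v → trans
          (cong (λ l → A u v * (Qpow (suc k) u v * (0ℚ * 0ℚ) + l * (1ℚ * 1ℚ))) (L-suc k u v))
          (solve 4 (λ a p c y → a :* (p :* (con 0ℚ :* con 0ℚ) :+ (c :* y) :* (con 1ℚ :* con 1ℚ)) := c :* (a :* y))
            refl (A u v) (Qpow (suc k) u v) (fromℕ (suc k)) (Qpow k u v * K u v)))
        (∑∑-*ˡ (fromℕ (suc k)) (λ u v → A u v * (Qpow k u v * K u v)))

    Q-nonNeg : ∀ u v → 0ℚ ≤ Q u v
    Q-nonNeg u v = 𝔼-nonNeg λ s t → 0≤-* (0≤-diff (η≤1 u s t)) (0≤-diff (η≤1 v s t))

    Q-≤1 : ∀ u v → Q u v ≤ 1ℚ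
    Q-≤1 u v = subst (Q u v ≤_) (𝔼-const 1ℚ) (𝔼-mono λ s t → ≤-by-diff
      (solve 2 (λ h g → con 1ℚ :- (con 1ℚ :- h) :* (con 1ℚ :- g) := h :* (con 1ℚ :- g) :+ g) refl (η u s t) (η v s t))
      (0≤-+ (0≤-* (0≤η u s t) (0≤-diff (η≤1 v s t))) (0≤η v s t)))

    -- A union bound: (1 - h)(1 - g) exceeds 1 - (h + g) by h g.
    Q-lower : ∀ u v → 1ℚ - (𝔼 (η u) + 𝔼 (η v)) ≤ Q u v
    Q-lower u v = subst (_≤ Q u v) avg (𝔼-mono λ s t → ≤-by-diff
      (solve 2 (λ h g → (con 1ℚ :- h) :* (con 1ℚ :- g) :- (con 1ℚ :+ con (- 1ℚ) :* (h :+ g)) := h :* g) refl (η u s t) (η v s t))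
      (0≤-* (0≤η u s t) (0≤η v s t)))
      where
      open ≡-Reasoning
      avg : 𝔼 (λ s t → 1ℚ + - 1ℚ * (η u s t + η v s t)) ≡ 1ℚ - (𝔼 (η u) + 𝔼 (η v))
      avg = begin
        𝔼 (λ s t → 1ℚ + - 1ℚ * (η u s t + η v s t))
          ≡⟨ 𝔼-+ (λ _ _ → 1ℚ) (λ s t → - 1ℚ * (η u s t + η v s t)) ⟩
        𝔼 (λ _ _ → 1ℚ) + 𝔼 (λ s t → - 1ℚ * (η u s t + η v s t))
          ≡⟨ cong₂ _+_ (𝔼-const 1ℚ) (trans (𝔼-*ˡ (- 1ℚ) (λ s t → η u s t + η v s t)) (cong (- 1ℚ *_) (𝔼-+ (η u) (η v)))) ⟩
        1ℚ + - 1ℚ * (𝔼 (η u) + 𝔼 (η v))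
          ≡⟨ solve 1 (λ s → con 1ℚ :+ con (- 1ℚ) :* s := con 1ℚ :- s) refl (𝔼 (η u) + 𝔼 (η v)) ⟩
        1ℚ - (𝔼 (η u) + 𝔼 (η v)) ∎

    Qpow-nonNeg : ∀ k u v → 0ℚ ≤ Qpow k u v
    Qpow-nonNeg zero    u v = ≤ᵇ⇒≤ _
    Qpow-nonNeg (suc k) u v = 0≤-* (Qpow-nonNeg k u v) (Q-nonNeg u v)

    Qpow-≤1 : ∀ k u v → Qpow k u v ≤ 1ℚ
    Qpow-≤1 zero    u v = ≤-refl
    Qpow-≤1 (suc k) u v = ≤-by-diff
      (solve 2 (λ p q → con 1ℚ :- p :* q := p :* (con 1ℚ :- q) :+ (con 1ℚ :- p)) refl (Qpow k u v) (Q u v))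
      (0≤-+ (0≤-* (Qpow-nonNeg k u v) (0≤-diff (Q-≤1 u v))) (0≤-diff (Qpow-≤1 k u v)))

    -- Bernoulli's inequality, with the induction carried by (1 - p)(1 - q) ≥ 0 for p, q at most 1.
    -- This form covers τ > 1 as well, which can happen for dense graphs.
    Qpow-bernoulli : ∀ k u v {τ} → 1ℚ - τ ≤ Q u v → 1ℚ - fromℕ k * τ ≤ Qpow k u v
    Qpow-bernoulli zero u v {τ} _ = ≤-by-diff
      (trans (cong (λ c → 1ℚ - (1ℚ - c * τ)) fromℕ-zero)
        (solve 1 (λ t → con 1ℚ :- (con 1ℚ :- con 0ℚ :* t) := con 0ℚ) refl τ)) ≤-refl
    Qpow-bernoulli (suc k) u v {τ} 1-τ≤q = ≤-by-diff
      (trans (cong (λ c → Qpow k u v * Q u v - (1ℚ - c * τ)) (fromℕ-suc k))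
        (solve 4 (λ p q t c →
           p :* q :- (con 1ℚ :- (con 1ℚ :+ c) :* t) :=
           (p :- (con 1ℚ :- c :* t)) :+ ((q :- (con 1ℚ :- t)) :+ (con 1ℚ :- p) :* (con 1ℚ :- q)))
           refl (Qpow k u v) (Q u v) τ (fromℕ k)))
      (0≤-+ (0≤-diff (Qpow-bernoulli k u v 1-τ≤q))
        (0≤-+ (0≤-diff 1-τ≤q) (0≤-* (0≤-diff (Qpow-≤1 k u v)) (0≤-diff (Q-≤1 u v)))))

-- Zero-one values, AM-GM and rounding to multiples

bit : Bool → ℚ
bit true  = 1ℚ
bit false = 0ℚ

0≤bit : ∀ b → 0ℚ ≤ bit b
0≤bit true  = ≤ᵇ⇒≤ _
0≤bit false = ≤-refl

-- The difference is - 1, 0 or 1, so its square is its absolute value. The square thus serves as a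
-- polynomial indicator that exactly one vertex of a pair lies in a neighbourhood.
bit-diff≤square : ∀ a b → bit a - bit b ≤ (bit a - bit b) * (bit a - bit b)
bit-diff≤square true  true  = ≤-refl
bit-diff≤square true  false = ≤-refl
bit-diff≤square false true  = ≤ᵇ⇒≤ _
bit-diff≤square false false = ≤-refl

bit-diff-square-comm : ∀ a b → (bit a - bit b) * (bit a - bit b) ≡ (bit b - bit a) * (bit b - bit a)
bit-diff-square-comm a b = solve 2 (λ a b → (a :- b) :* (a :- b) := (b :- a) :* (b :- a)) refl (bit a) (bit b)

bit-diff-square≤1 : ∀ a b → (bit a - bit b) * (bit a - bit b) ≤ 1ℚ
bit-diff-square≤1 true  true  = ≤ᵇ⇒≤ _
bit-diff-square≤1 true  false = ≤-refl
bit-diff-square≤1 false true  = ≤-refl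
bit-diff-square≤1 false false = ≤ᵇ⇒≤ _

bit-diff-square≤sum : ∀ a b → (bit a - bit b) * (bit a - bit b) ≤ bit a + bit b
bit-diff-square≤sum true  true  = ≤ᵇ⇒≤ _
bit-diff-square≤sum true  false = ≤-refl
bit-diff-square≤sum false true  = ≤-refl
bit-diff-square≤sum false false = ≤-refl

∑-elem≤ : ∀ {n} (f : Fin n → ℚ) → (∀ i → 0ℚ ≤ f i) → ∀ i → f i ≤ ∑ f
∑-elem≤ f 0≤f zero = ≤-by-diff
  (trans (cong (_- f zero) (∑-suc f)) (solve 2 (λ a s → a :+ s :- a := s) refl (f zero) _))
  (∑-nonNeg λ i → 0≤f (suc i))
∑-elem≤ f 0≤f (suc i) = ≤-trans (∑-elem≤ (λ i → f (suc i)) (λ i → 0≤f (suc i)) i)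
  (≤-by-diff (trans (cong (_- ∑ (λ i → f (suc i))) (∑-suc f)) (solve 2 (λ a s → a :+ s :- s := a) refl (f zero) _)) (0≤f zero))

∑∑-fst : ∀ {m} n (f : Fin m → ℚ) → ∑∑ {m} {n} (λ s _ → f s) ≡ fromℕ n * ∑ f
∑∑-fst n f = trans (∑-cong λ s → ∑-const n (f s)) (∑-*ˡ (fromℕ n) f)

∑∑-snd : ∀ m {n} (f : Fin n → ℚ) → ∑∑ {m} {n} (λ _ t → f t) ≡ fromℕ m * ∑ f
∑∑-snd m f = ∑-const m (∑ f)

-- With p = a + b the claim times p² is xy (a − b)² + (p − 2)² (p + 1) ≥ 0.
three-term-am-gm : ∀ {x y a b} → 0ℚ ≤ x → 0ℚ ≤ y → 0ℚ < a → 0ℚ < b → x * a ≡ 1ℚ → y * b ≡ 1ℚ →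
                   3ℚ ≤ x * y + a + b
three-term-am-gm {x} {y} {a} {b} 0≤x 0≤y 0<a 0<b xa yb =
  ≤-by-diff refl (0≤-cancel (0<-* 0<p 0<p) (0≤-by identity
    (0≤-+ (0≤-* (0≤-* 0≤x 0≤y) (0≤-square (a - b)))
          (0≤-* (0≤-square (a + b - 2ℚ)) (0≤-+ (<⇒≤ 0<p) (≤ᵇ⇒≤ _))))))
  where
  open ≡-Reasoning
  0<p : 0ℚ < a + b
  0<p = +-mono-< 0<a 0<b
  identity : (a + b) * (a + b) * (x * y + a + b - 3ℚ) ≡
             x * y * ((a - b) * (a - b)) + (a + b - 2ℚ) * (a + b - 2ℚ) * (a + b + 1ℚ)
  identity = begin
    (a + b) * (a + b) * (x * y + a + b - 3ℚ)
      ≡⟨ solve 4 (λ x y a b →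
           (a :+ b) :* (a :+ b) :* (x :* y :+ a :+ b :- con 3ℚ) :=
           x :* y :* ((a :- b) :* (a :- b)) :+ (con 4ℚ :* ((x :* a) :* (y :* b)) :+ (a :+ b) :* (a :+ b) :* (a :+ b :- con 3ℚ)))
           refl x y a b ⟩
    x * y * ((a - b) * (a - b)) + (4ℚ * ((x * a) * (y * b)) + (a + b) * (a + b) * (a + b - 3ℚ))
      ≡⟨ cong₂ (λ g h → x * y * ((a - b) * (a - b)) + (4ℚ * (g * h) + (a + b) * (a + b) * (a + b - 3ℚ))) xa yb ⟩
    x * y * ((a - b) * (a - b)) + (4ℚ * (1ℚ * 1ℚ) + (a + b) * (a + b) * (a + b - 3ℚ))
      ≡⟨ solve 3 (λ q a b →
           q :+ (con 4ℚ :* (con 1ℚ :* con 1ℚ) :+ (a :+ b) :* (a :+ b) :* (a :+ b :- con 3ℚ)) :=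
           q :+ (a :+ b :- con 2ℚ) :* (a :+ b :- con 2ℚ) :* (a :+ b :+ con 1ℚ))
           refl (x * y * ((a - b) * (a - b))) a b ⟩
    x * y * ((a - b) * (a - b)) + (a + b - 2ℚ) * (a + b - 2ℚ) * (a + b + 1ℚ) ∎

abstract
  -- The numerator plus one suffices, since the denominator is at least 1.
  archimedean : ∀ p → 0ℚ ≤ p → Σ ℕ λ k → p < fromℕ k
  archimedean p@(mkℚ (+ m) d-1 _) _ = suc m , subst (p <_) (≡-sym (fromℕ-def (suc m))) (toℚᵘ-cancel-< (ℚᵘP.<-respʳ-≃ (ℚᵘP.≃-sym (toℚᵘ-fromℚᵘ (+ suc m ℚᵘ./ 1)))
    (ℚᵘ.*<* (subst₂ ℤ._<_ (≡-sym (ℤP.*-identityʳ (+ m))) refl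
      (ℤ.+<+ (ℕP.<-≤-trans (ℕP.n<1+n m) (ℕP.m≤m*n (suc m) (suc d-1))))))))
  archimedean (mkℚ ℤ.-[1+ _ ] _ _) (*≤* ())

-- This fixes the number of pairs as `suc j`: few enough that the loss `j` · `τ` fits the budget
-- `α`, and enough that one more step of `τ` would reach it. The search descends from an Archimedean
-- bound.
multiple-floor : ∀ τ α → 0ℚ < τ → 0ℚ ≤ α → Σ ℕ λ j → (fromℕ j * τ ≤ α) × (α ≤ fromℕ (suc j) * τ)
multiple-floor τ α 0<τ 0≤α = descend k exceeds
  where
  k = proj₁ (archimedean (α * inv τ) (0≤-* 0≤α (<⇒≤ (inv-pos 0<τ))))
  exceeds : α ≤ fromℕ k * τ
  exceeds = begin
    α                   ≡⟨ *-identityʳ α ⟨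
    α * 1ℚ              ≡⟨ cong (α *_) (*-inv 0<τ) ⟨
    α * (τ * inv τ)     ≡⟨ solve 3 (λ a t i → a :* (t :* i) := t :* (a :* i)) refl α τ (inv τ) ⟩
    τ * (α * inv τ)     ≤⟨ *-monoˡ-≤ (<⇒≤ 0<τ) (<⇒≤ (proj₂ (archimedean (α * inv τ) (0≤-* 0≤α (<⇒≤ (inv-pos 0<τ)))))) ⟩
    τ * fromℕ k         ≡⟨ *-comm τ (fromℕ k) ⟩
    fromℕ k * τ         ∎
    where open ≤-Reasoning
  descend : ∀ k → α ≤ fromℕ k * τ → Σ ℕ λ j → (fromℕ j * τ ≤ α) × (α ≤ fromℕ (suc j) * τ)
  descend zero α≤0 = zero , ≤-trans (≤-reflexive 0τ≡0) 0≤α , ≤-trans α≤0 (*-monoʳ-≤-nonNeg τ {{nonNegative (<⇒≤ 0<τ)}} (fromℕ-mono (ℕ.z≤n {1})))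
    where
    0τ≡0 : fromℕ 0 * τ ≡ 0ℚ
    0τ≡0 = trans (cong (_* τ) fromℕ-zero) (*-zeroˡ τ)
  descend (suc k) α≤ with ≤-total α (fromℕ k * τ)
  ... | inj₁ le = descend k le
  ... | inj₂ ge = k , ge , α≤

¼ : ℚ
¼ = + 1 / 4

-- Damped neighbourhood signals and the number of pairs

module SurplusBound
  (n : ℕ) .{{_ : NonZero n}}
  (adjacent : Fin n → Fin n → Bool)
  (adjacent-sym : ∀ u v → adjacent u v ≡ adjacent v u)
  (ε : ℚ) (0<ε : 0ℚ < ε) (ε≤1 : ε ≤ 1ℚ)
  (d : ℚ) (0<d : 0ℚ < d)
  where

  A : Fin n → Fin n → ℚ
  A u v = bit (adjacent u v)

  A-sym : ∀ u v → A u v ≡ A v u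
  A-sym u v = cong bit (adjacent-sym u v)

  0≤A : ∀ u v → 0ℚ ≤ A u v
  0≤A u v = 0≤bit (adjacent u v)

  deg : Fin n → ℚ
  deg u = ∑ (A u)

  0≤deg : ∀ u → 0ℚ ≤ deg u
  0≤deg u = ∑-nonNeg (0≤A u)

  codeg : Fin n → Fin n → ℚ
  codeg u v = ∑ λ s → A u s * A v s

  0≤codeg : ∀ u v → 0ℚ ≤ codeg u v
  0≤codeg u v = ∑-nonNeg λ s → 0≤-* (0≤A u s) (0≤A v s)

  N i : ℚ
  N = fromℕ n
  i = inv N

  0<N : 0ℚ < N
  0<N = fromℕ-pos n

  0<i : 0ℚ < i
  0<i = inv-pos 0<N

  0≤ε = <⇒≤ 0<ε
  0≤d = <⇒≤ 0<d
  0≤N = <⇒≤ 0<N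
  0≤i = <⇒≤ 0<i

  damping-denominator : Fin n → ℚ
  damping-denominator u = 4ℚ * d + ε * deg u

  0<denominator : ∀ u → 0ℚ < damping-denominator u
  0<denominator u = +-mono-<-≤ (0<-* {4ℚ} (positive⁻¹ 4ℚ) 0<d) (0≤-* 0≤ε (0≤deg u))

  -- `f` is the damped degree 4dg/(4d + εg) with g = `deg u`: close to g while g is small against
  -- d/ε, and saturating at 4d/ε. Its reciprocal is affine in 1/g.
  w f : Fin n → ℚ
  w u = 4ℚ * d * inv (damping-denominator u)
  f u = w u * deg u

  w-spec : ∀ u → w u * damping-denominator u ≡ 4ℚ * d
  w-spec u = begin
    4ℚ * d * inv D * D       ≡⟨ solve 3 (λ a D j → a :* j :* D := a :* (D :* j)) refl (4ℚ * d) D (inv D) ⟩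
    4ℚ * d * (D * inv D)     ≡⟨ cong (4ℚ * d *_) (*-inv (0<denominator u)) ⟩
    4ℚ * d * 1ℚ              ≡⟨ *-identityʳ (4ℚ * d) ⟩
    4ℚ * d                   ∎
    where
    open ≡-Reasoning
    D = damping-denominator u

  0≤w : ∀ u → 0ℚ ≤ w u
  0≤w u = 0≤-* (0≤-* {4ℚ} (≤ᵇ⇒≤ _) 0≤d) (<⇒≤ (inv-pos (0<denominator u)))

  0≤f : ∀ u → 0ℚ ≤ f u
  0≤f u = 0≤-* (0≤w u) (0≤deg u)

  w≤1 : ∀ u → w u ≤ 1ℚ
  w≤1 u = ≤-by-diff
    (begin
      1ℚ - w u                              ≡⟨ cong (_- w u) (*-inv (0<denominator u)) ⟨
      (4ℚ * d + ε * deg u) * j - 4ℚ * d * j ≡⟨ solve 3 (λ a b j → (a :+ b) :* j :- a :* j := b :* j) refl (4ℚ * d) (ε * deg u) j ⟩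
      ε * deg u * j                         ∎)
    (0≤-* (0≤-* 0≤ε (0≤deg u)) (<⇒≤ (inv-pos (0<denominator u))))
    where
    open ≡-Reasoning
    j = inv (damping-denominator u)

  -- `F` is the saturation value of `f`. A pair costs each endpoint of an edge at most 2F/n on
  -- average, so `τ` bounds the loss 1 - `Q` at the edge.
  F τ : ℚ
  F = 4ℚ * d * inv ε
  τ = 4ℚ * (i * F)

  0<F : 0ℚ < F
  0<F = 0<-* (0<-* {4ℚ} (positive⁻¹ 4ℚ) 0<d) (inv-pos 0<ε)

  0<τ : 0ℚ < τ
  0<τ = 0<-* {4ℚ} (positive⁻¹ 4ℚ) (0<-* 0<i 0<F)

  f≤F : ∀ u → f u ≤ F
  f≤F u = ≤-by-diff
    (begin
      4ℚ * d * e - w u * deg u                      ≡⟨ solve 2 (λ x y → x :- y := x :- con 1ℚ :* y) refl (4ℚ * d * e) (w u * deg u) ⟩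
      4ℚ * d * e - 1ℚ * (w u * deg u)               ≡⟨ cong₂ (λ x y → x * e - y * (w u * deg u)) (w-spec u) (*-inv 0<ε) ⟨
      w u * (4ℚ * d + ε * deg u) * e - ε * e * (w u * deg u)
        ≡⟨ solve 5 (λ w d ε g e → w :* (con 4ℚ :* d :+ ε :* g) :* e :- ε :* e :* (w :* g) := w :* (con 4ℚ :* d) :* e) refl (w u) d ε (deg u) e ⟩
      w u * (4ℚ * d) * e ∎)
    (0≤-* (0≤-* (0≤w u) (0≤-* {4ℚ} (≤ᵇ⇒≤ _) 0≤d)) (<⇒≤ (inv-pos 0<ε)))
    where
    open ≡-Reasoning
    e = inv ε

  r : ℚ
  r = i * i

  i*N : i * N ≡ 1ℚ
  i*N = trans (*-comm i N) (*-inv 0<N)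

  r-inverse : r * (N * N) ≡ 1ℚ
  r-inverse = trans (solve 2 (λ i N → i :* i :* (N :* N) := (i :* N) :* (i :* N)) refl i N) (cong₂ _*_ i*N i*N)

  open PairAverage n r (0≤-* 0≤i 0≤i) r-inverse

  ξ η : Fin n → Fin n → Fin n → ℚ
  ξ u s t = w u * (A u s - A u t)
  η u s t = w u * ((A u s - A u t) * (A u s - A u t))

  -- Each of `s` and `t` falls into the neighbourhood of `u` with probability deg(u)/n, whence the
  -- factor two; damping turns the degree into `f u`.
  𝔼η≤ : ∀ u → 𝔼 (η u) ≤ 2ℚ * (i * F)
  𝔼η≤ u = begin
    𝔼 (η u)
      ≤⟨ 𝔼-mono (λ s t → *-monoˡ-≤ (0≤w u) (bit-diff-square≤sum (adjacent u s) (adjacent u t))) ⟩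
    𝔼 (λ s t → w u * (A u s + A u t))
      ≡⟨ 𝔼-*ˡ (w u) (λ s t → A u s + A u t) ⟩
    w u * (r * ∑∑ (λ s t → A u s + A u t))
      ≡⟨ cong (λ y → w u * (r * y)) (trans (∑∑-+ (λ s _ → A u s) (λ _ t → A u t)) (cong₂ _+_ (∑∑-fst n (A u)) (∑∑-snd n (A u)))) ⟩
    w u * (i * i * (N * deg u + N * deg u))
      ≡⟨ solve 4 (λ w i N g → w :* (i :* i :* (N :* g :+ N :* g)) := con 2ℚ :* (i :* (w :* g)) :* (i :* N)) refl (w u) i N (deg u) ⟩
    2ℚ * (i * f u) * (i * N)
      ≡⟨ trans (cong (2ℚ * (i * f u) *_) i*N) (*-identityʳ (2ℚ * (i * f u))) ⟩
    2ℚ * (i * f u)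
      ≤⟨ *-monoˡ-≤ {2ℚ} (≤ᵇ⇒≤ _) (*-monoˡ-≤ 0≤i (f≤F u)) ⟩
    2ℚ * (i * F) ∎
    where open ≤-Reasoning

  -- The two products using the same sampled vertex average to codeg/n each; the two mixing `s` with
  -- `t` factor by independence into deg · deg / n².
  𝔼ξξ : ∀ u v → 𝔼 (λ s t → ξ u s t * ξ v s t) ≡
        2ℚ * r * (w u * w v * (N * codeg u v - deg u * deg v))
  𝔼ξξ u v = begin
    𝔼 (λ s t → ξ u s t * ξ v s t)
      ≡⟨ 𝔼-cong (λ s t → solve 6 (λ wu wv us ut vs vt →
           (wu :* (us :- ut)) :* (wv :* (vs :- vt)) :=
           ((wu :* wv) :* (us :* vs) :+ (wu :* wv) :* (ut :* vt)) :+
           ((:- (wu :* wv)) :* (us :* vt) :+ (:- (wu :* wv)) :* (vs :* ut)))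
           refl (w u) (w v) (A u s) (A u t) (A v s) (A v t)) ⟩
    𝔼 (λ s t → (c * (A u s * A v s) + c * (A u t * A v t)) + (- c * (A u s * A v t) + - c * (A v s * A u t)))
      ≡⟨ 𝔼-linear₄ c c (- c) (- c) (λ s _ → A u s * A v s) (λ _ t → A u t * A v t)
                   (λ s t → A u s * A v t) (λ s t → A v s * A u t) ⟩
    (c * (r * ∑∑ {n} {n} (λ s _ → A u s * A v s)) + c * (r * ∑∑ {n} {n} (λ _ t → A u t * A v t))) +
    (- c * (r * ∑∑ (λ s t → A u s * A v t)) + - c * (r * ∑∑ (λ s t → A v s * A u t)))
      ≡⟨ cong₂ _+_
           (cong₂ (λ x y → c * (r * x) + c * (r * y)) (∑∑-fst n (λ s → A u s * A v s)) (∑∑-snd n (λ t → A u t * A v t)))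
           (cong₂ (λ x y → - c * (r * x) + - c * (r * y)) (∑∑-product (A u) (A v)) (∑∑-product (A v) (A u))) ⟩
    (c * (r * (N * codeg u v)) + c * (r * (N * codeg u v))) +
    (- c * (r * (deg u * deg v)) + - c * (r * (deg v * deg u)))
      ≡⟨ solve 5 (λ c r p g h →
           (c :* (r :* p) :+ c :* (r :* p)) :+ ((:- c) :* (r :* (g :* h)) :+ (:- c) :* (r :* (h :* g))) :=
           con 2ℚ :* r :* (c :* (p :- g :* h))) refl c r (N * codeg u v) (deg u) (deg v) ⟩
    2ℚ * r * (c * (N * codeg u v - deg u * deg v)) ∎
    where
    open ≡-Reasoning
    c = w u * w v

  W S : ℚ
  W = ∑∑ λ u v → A u v * (f u * f v)
  S = ∑∑ λ u v → A u v * codeg u v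

  module _ (N*d : N * d ≡ ∑ deg) where

    -- a u = d / f u when deg u > 0, and 0 (from inv 0 = 0) at isolated vertices.
    a : Fin n → ℚ
    a u = inv (deg u) * (d + ε * ¼ * deg u)

    -- An equality except at isolated vertices, where the left side vanishes. An upper bound is the
    -- useful direction, because these terms are subtracted in `W-lower`.
    deg*a≤ : ∀ u → a u * deg u ≤ d + ε * ¼ * deg u
    deg*a≤ u with 0≤⇒≡0⊎0< (0≤deg u)
    ... | inj₁ deg≡0 = ≤-by-diff
      (begin
        d + ε * ¼ * g - a u * g   ≡⟨ cong (λ x → d + ε * ¼ * x - a u * x) deg≡0 ⟩
        d + ε * ¼ * 0ℚ - a u * 0ℚ ≡⟨ solve 3 (λ d e a → d :+ e :* con 0ℚ :- a :* con 0ℚ := d) refl d (ε * ¼) (a u) ⟩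
        d ∎) 0≤d
      where
      open ≡-Reasoning
      g = deg u
    ... | inj₂ 0<deg = ≤-reflexive (begin
        inv g * e * g    ≡⟨ solve 3 (λ j e g → j :* e :* g := (g :* j) :* e) refl (inv g) e g ⟩
        (g * inv g) * e  ≡⟨ cong (_* e) (*-inv 0<deg) ⟩
        1ℚ * e           ≡⟨ *-identityˡ e ⟩
        e                ∎)
      where
      open ≡-Reasoning
      g = deg u
      e = d + ε * ¼ * g

    -- AM-GM for the three numbers f(u)f(v)/d², d/f(u) and d/f(v), whose product is 1. It replaces
    -- the product over an edge by a sum of one-vertex terms, which can be summed without knowing
    -- how degrees are correlated along edges.
    edge-weight-lower : ∀ u v → A u v * (d * d * (3ℚ - (a u + a v))) ≤ A u v * (f u * f v)
    edge-weight-lower u v = go (adjacent u v) refl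
      where
      open ≡-Reasoning
      go : ∀ b → adjacent u v ≡ b → A u v * (d * d * (3ℚ - (a u + a v))) ≤ A u v * (f u * f v)
      go false eq = ≤-reflexive (trans (cong (λ b → bit b * (d * d * (3ℚ - (a u + a v)))) eq)
        (trans (solve 2 (λ x y → con 0ℚ :* x := con 0ℚ :* y) refl (d * d * (3ℚ - (a u + a v))) (f u * f v))
               (cong (λ b → bit b * (f u * f v)) (≡-sym eq))))
      -- An edge makes both degrees positive, so `a` really is the reciprocal of `δ * f` at its two
      -- ends.
      go true eq = *-monoˡ-≤ (0≤A u v) (≤-by-diff identity
        (0≤-* (0≤-* 0≤d 0≤d) (0≤-diff (three-term-am-gm (0≤-* 0≤δ (0≤f u)) (0≤-* 0≤δ (0≤f v))
          (0<a u 0<deg-u) (0<a v 0<deg-v) (x*a u 0<deg-u) (x*a v 0<deg-v)))))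
        where
        δ = inv d
        0≤δ = <⇒≤ (inv-pos 0<d)

        0<deg-u : 0ℚ < deg u
        0<deg-u = <-≤-trans (subst (λ b → 0ℚ < bit b) (≡-sym eq) (positive⁻¹ 1ℚ)) (∑-elem≤ (A u) (0≤A u) v)

        0<deg-v : 0ℚ < deg v
        0<deg-v = <-≤-trans (subst (λ b → 0ℚ < bit b) (≡-sym (trans (adjacent-sym v u) eq)) (positive⁻¹ 1ℚ)) (∑-elem≤ (A v) (0≤A v) u)

        0<a : ∀ u → 0ℚ < deg u → 0ℚ < a u
        0<a u 0<deg = 0<-* (inv-pos 0<deg) (+-mono-<-≤ 0<d (0≤-* (0≤-* {ε} {¼} 0≤ε (≤ᵇ⇒≤ _)) (0≤deg u)))

        x*a : ∀ u → 0ℚ < deg u → δ * f u * a u ≡ 1ℚ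
        x*a u 0<deg = begin
          δ * (w u * g) * (inv g * (d + ε * ¼ * g))
            ≡⟨ solve 6 (λ δ w g j d ε → δ :* (w :* g) :* (j :* (d :+ ε :* con ¼ :* g)) :=
                 con ¼ :* δ :* (g :* j) :* (w :* (con 4ℚ :* d :+ ε :* g))) refl δ (w u) g (inv g) d ε ⟩
          ¼ * δ * (g * inv g) * (w u * (4ℚ * d + ε * g))
            ≡⟨ cong₂ (λ x y → ¼ * δ * x * y) (*-inv 0<deg) (w-spec u) ⟩
          ¼ * δ * 1ℚ * (4ℚ * d)
            ≡⟨ solve 2 (λ δ d → con ¼ :* δ :* con 1ℚ :* (con 4ℚ :* d) := d :* δ) refl δ d ⟩
          d * δ
            ≡⟨ *-inv 0<d ⟩
          1ℚ ∎
          where g = deg u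

        identity : f u * f v - d * d * (3ℚ - (a u + a v)) ≡
                   d * d * (δ * f u * (δ * f v) + a u + a v - 3ℚ)
        identity = begin
          f u * f v - d * d * (3ℚ - (a u + a v))
            ≡⟨ solve 4 (λ d p g h → p :- d :* d :* (con 3ℚ :- (g :+ h)) :=
                  con 1ℚ :* con 1ℚ :* p :- d :* d :* (con 3ℚ :- (g :+ h))) refl d (f u * f v) (a u) (a v) ⟩
          1ℚ * 1ℚ * (f u * f v) - d * d * (3ℚ - (a u + a v))
            ≡⟨ cong (λ x → x * x * (f u * f v) - d * d * (3ℚ - (a u + a v))) (*-inv 0<d) ⟨
          (d * δ) * (d * δ) * (f u * f v) - d * d * (3ℚ - (a u + a v))
            ≡⟨ solve 6 (λ d δ p q g h → (d :* δ) :* (d :* δ) :* (p :* q) :- d :* d :* (con 3ℚ :- (g :+ h)) :=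
                 d :* d :* (δ :* p :* (δ :* q) :+ g :+ h :- con 3ℚ)) refl d δ (f u) (f v) (a u) (a v) ⟩
          d * d * (δ * f u * (δ * f v) + a u + a v - 3ℚ) ∎

    -- There are nd ordered adjacent pairs, so the constant 3 contributes 3nd³. Each of the two
    -- linear terms costs at most nd³(1 + ε/4), because the degree cancels in d/deg(u) when summed
    -- over the neighbours of u.
    W-lower : (1ℚ - ½ * ε) * (N * (d * d * d)) ≤ W
    W-lower = begin
      (1ℚ - ½ * ε) * (N * (d * d * d))
        ≡⟨ solve 3 (λ ε N d → (con 1ℚ :- con ½ :* ε) :* (N :* (d :* d :* d)) :=
             con 3ℚ :* (d :* d) :* (N :* d) :- con 2ℚ :* (d :* d) :* (N :* d :+ ε :* con ¼ :* (N :* d))) refl ε N d ⟩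
      3ℚ * (d * d) * (N * d) - 2ℚ * (d * d) * (N * d + ε * ¼ * (N * d))
        ≡⟨ cong (λ y → 3ℚ * (d * d) * (N * d) - 2ℚ * (d * d) * y) sum-bound ⟨
      3ℚ * (d * d) * (N * d) - 2ℚ * (d * d) * ∑ (λ u → d + ε * ¼ * deg u)
        ≤⟨ ≤-by-diff (solve 4 (λ q r x y → (q :- r :* x) :- (q :- r :* y) := r :* (y :- x)) refl
              (3ℚ * (d * d) * (N * d)) (2ℚ * (d * d)) (∑ λ u → a u * deg u) (∑ λ u → d + ε * ¼ * deg u))
             (0≤-* (0≤-* {2ℚ} (≤ᵇ⇒≤ _) (0≤-* 0≤d 0≤d)) (0≤-diff (∑-mono deg*a≤))) ⟩
      3ℚ * (d * d) * (N * d) - 2ℚ * (d * d) * ∑ (λ u → a u * deg u)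
        ≡⟨ sum-identity ⟨
      ∑∑ (λ u v → A u v * (d * d * (3ℚ - (a u + a v))))
        ≤⟨ ∑∑-mono edge-weight-lower ⟩
      W ∎
      where
      open ≤-Reasoning
      sum-bound : ∑ (λ u → d + ε * ¼ * deg u) ≡ N * d + ε * ¼ * (N * d)
      sum-bound = trans (∑-+ (λ _ → d) (λ u → ε * ¼ * deg u))
        (cong₂ _+_ (∑-const n d) (trans (∑-*ˡ (ε * ¼) deg) (cong (ε * ¼ *_) (≡-sym N*d))))

      left : ∑∑ (λ u v → a u * A u v) ≡ ∑ (λ u → a u * deg u)
      left = ∑-cong λ u → ∑-*ˡ (a u) (A u)

      right : ∑∑ (λ u v → a v * A u v) ≡ ∑ (λ u → a u * deg u)
      right = trans (∑-comm λ u v → a v * A u v)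
        (trans (∑∑-cong λ v u → cong (a v *_) (A-sym u v)) left)

      sum-identity : ∑∑ (λ u v → A u v * (d * d * (3ℚ - (a u + a v)))) ≡
        3ℚ * (d * d) * (N * d) - 2ℚ * (d * d) * ∑ (λ u → a u * deg u)
      sum-identity = begin-equality
        ∑∑ (λ u v → A u v * (d * d * (3ℚ - (a u + a v))))
          ≡⟨ ∑∑-cong (λ u v → solve 4 (λ A d g h → A :* (d :* d :* (con 3ℚ :- (g :+ h))) :=
               (con 3ℚ :* (d :* d)) :* A :+ (:- (d :* d)) :* (g :* A :+ h :* A)) refl (A u v) d (a u) (a v)) ⟩
        ∑∑ (λ u v → (3ℚ * (d * d)) * A u v + (- (d * d)) * (a u * A u v + a v * A u v))
          ≡⟨ ∑∑-linear (3ℚ * (d * d)) (- (d * d)) A (λ u v → a u * A u v + a v * A u v) ⟩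
        3ℚ * (d * d) * ∑ deg + (- (d * d)) * ∑∑ (λ u v → a u * A u v + a v * A u v)
          ≡⟨ cong₂ (λ x y → 3ℚ * (d * d) * x + (- (d * d)) * y) (≡-sym N*d)
               (trans (∑∑-+ (λ u v → a u * A u v) (λ u v → a v * A u v)) (cong₂ _+_ left right)) ⟩
        3ℚ * (d * d) * (N * d) + (- (d * d)) * (T + T)
          ≡⟨ solve 3 (λ q d t → q :+ (:- (d :* d)) :* (t :+ t) := q :- con 2ℚ :* (d :* d) :* t) refl (3ℚ * (d * d) * (N * d)) d T ⟩
        3ℚ * (d * d) * (N * d) - 2ℚ * (d * d) * T ∎
        where T = ∑ (λ u → a u * deg u)

    module _ (B : ℚ) (on-cube : ∀ x → InBox x → 0ℚ ≤ B + quad A x)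
             (few-triangles : S ≤ (1ℚ - ε) * (d * d * d)) where

      open Process A B on-cube ξ η
        (λ u s t → solve 3 (λ w p q → w :* (q :- p) := :- (w :* (p :- q))) refl (w u) (A u s) (A u t))
        (λ u s t → cong (w u *_) (bit-diff-square-comm (adjacent u t) (adjacent u s)))
        (λ u s t → *-monoˡ-≤ (0≤w u) (bit-diff≤square (adjacent u s) (adjacent u t)))
        (λ u s t → subst₂ _≤_
           (solve 3 (λ w p q → w :* (q :- p) := :- (w :* (p :- q))) refl (w u) (A u s) (A u t))
           (cong (w u *_) (bit-diff-square-comm (adjacent u t) (adjacent u s)))
           (*-monoˡ-≤ (0≤w u) (bit-diff≤square (adjacent u t) (adjacent u s))))
        (λ u s t → ≤-trans (*-monoˡ-≤ (0≤w u) (bit-diff-square≤1 (adjacent u s) (adjacent u t)))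
                           (subst (_≤ 1ℚ) (≡-sym (*-identityʳ (w u))) (w≤1 u)))

      Q≥1-τ : ∀ u v → 1ℚ - τ ≤ Q u v
      Q≥1-τ u v = ≤-trans (≤-by-diff
        (solve 3 (λ x y z → (con 1ℚ :- (x :+ y)) :- (con 1ℚ :- con 4ℚ :* z) := (con 2ℚ :* z :- x) :+ (con 2ℚ :* z :- y))
          refl (𝔼 (η u)) (𝔼 (η v)) (i * F))
        (0≤-+ (0≤-diff (𝔼η≤ u)) (0≤-diff (𝔼η≤ v)))) (Q-lower u v)

      -- `K` has no definite sign, so its two parts are estimated separately. In the codegree part
      -- all damping factors are bounded above by 1; in the negative degree part `w` is kept inside
      -- `f`, and `Qpow` is bounded below by Bernoulli.
      edge-kernel-upper : ∀ j u v → A u v * (Qpow j u v * K u v) ≤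
        2ℚ * r * N * (A u v * codeg u v) + - (2ℚ * r * (1ℚ - fromℕ j * τ)) * (A u v * (f u * f v))
      edge-kernel-upper j u v = ≤-by-diff
        (trans (cong (λ k → 2ℚ * r * N * (A u v * codeg u v) + - (2ℚ * r * (1ℚ - fromℕ j * τ)) * (A u v * (f u * f v))
                            - A u v * (p * k)) (𝔼ξξ u v))
          (solve 10 (λ r N A c σ wu wv g h p →
             con 2ℚ :* r :* N :* (A :* c) :+ (:- (con 2ℚ :* r :* σ)) :* (A :* ((wu :* g) :* (wv :* h)))
               :- A :* (p :* (con 2ℚ :* r :* (wu :* wv :* (N :* c :- g :* h)))) :=
             con 2ℚ :* r :* (N :* (A :* c) :* (con 1ℚ :- p :* (wu :* wv)) :+ A :* ((wu :* g) :* (wv :* h)) :* (p :- σ)))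
             refl r N (A u v) (codeg u v) (1ℚ - fromℕ j * τ) (w u) (w v) (deg u) (deg v) p))
        (0≤-* (0≤-* {2ℚ} (≤ᵇ⇒≤ _) (0≤-* 0≤i 0≤i))
          (0≤-+ (0≤-* (0≤-* 0≤N (0≤-* (0≤A u v) (0≤codeg u v)))
                      (0≤-diff (≤1-* (Qpow-nonNeg j u v) (Qpow-≤1 j u v) (≤1-* (0≤w u) (w≤1 u) (w≤1 v)))))
                (0≤-* (0≤-* (0≤A u v) (0≤-* (0≤f u) (0≤f v))) (0≤-diff (Qpow-bernoulli j u v (Q≥1-τ u v))))))
        where
        p = Qpow j u v
        ≤1-* : ∀ {p q} → 0ℚ ≤ p → p ≤ 1ℚ → q ≤ 1ℚ → p * q ≤ 1ℚ
        ≤1-* {p} {q} 0≤p p≤1 q≤1 = ≤-trans (*-monoˡ-≤ 0≤p q≤1) (subst (_≤ 1ℚ) (≡-sym (*-identityʳ p)) p≤1)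

      -- The first inequality on `j` controls the loss, the second the gain. With τ = 16d/(εn) the
      -- latter gives at least ε²n/(64d) pairs, each worth (2/n²)(ε/4)nd³; the product is ε³d²/128.
      -- The value `j` = 0, a single pair, is allowed.
      lower-bound-at : ∀ j → fromℕ j * τ ≤ ε * ¼ → ε * ¼ ≤ fromℕ (suc j) * τ →
                       (+ 1 / 128) * (ε * ε * ε) * (d * d) ≤ B
      lower-bound-at j jτ≤ ≤cτ = ≤-trans step₁ (≤-by-diff
        (solve 2 (λ b y → b :- (:- y) := b :+ y) refl B (c * Z)) 0≤B+cZ)
        where
        c = fromℕ (suc j)
        0≤c = fromℕ-nonNeg (suc j)
        σ = 1ℚ - fromℕ j * τ
        Z = 2ℚ * r * N * S + - (2ℚ * r * σ) * W
        D = N * (d * d * d)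
        0≤D : 0ℚ ≤ D
        0≤D = 0≤-* 0≤N (0≤-* (0≤-* 0≤d 0≤d) 0≤d)

        0≤B+cZ : 0ℚ ≤ B + c * Z
        0≤B+cZ = ≤-trans (process-bound j) (+-monoʳ-≤ B (*-monoˡ-≤ 0≤c
          (≤-trans (∑∑-mono (edge-kernel-upper j))
            (≤-reflexive (∑∑-linear (2ℚ * r * N) (- (2ℚ * r * σ)) (λ u v → A u v * codeg u v) (λ u v → A u v * (f u * f v)))))))

        0≤1-ε/4 : 0ℚ ≤ 1ℚ - ε * ¼
        0≤1-ε/4 = 0≤-by (solve 1 (λ e → con 1ℚ :- e :* con ¼ := con ¼ :* (con 1ℚ :- e) :+ con (1ℚ - ¼)) refl ε)
          (0≤-+ (0≤-* {¼} (≤ᵇ⇒≤ _) (0≤-diff ε≤1)) (≤ᵇ⇒≤ _))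

        0≤σ : 0ℚ ≤ σ
        0≤σ = 0≤-by (solve 2 (λ x y → con 1ℚ :- x := (con 1ℚ :- y) :+ (y :- x)) refl (fromℕ j * τ) (ε * ¼))
                    (0≤-+ 0≤1-ε/4 (0≤-diff jτ≤))

        -- The loss budget: (1 - ε/4)(1 - ε/2) - (1 - ε) = ε/4 + ε²/8, with ε/4 lost to overlap, ε/2
        -- to damping, and 1 - ε from the triangle hypothesis.
        bracket : ε * ¼ * D ≤ σ * W - N * S
        bracket = begin
          ε * ¼ * D
            ≤⟨ ≤-by-diff (solve 2 (λ ε D →
                 ((con 1ℚ :- ε :* con ¼) :* ((con 1ℚ :- con ½ :* ε) :* D) :- (con 1ℚ :- ε) :* D) :- ε :* con ¼ :* D :=
                 con (+ 1 / 8) :* (ε :* ε) :* D) refl ε D)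
                 (0≤-* (0≤-* {+ 1 / 8} (≤ᵇ⇒≤ _) (0≤-square ε)) 0≤D) ⟩
          (1ℚ - ε * ¼) * ((1ℚ - ½ * ε) * D) - (1ℚ - ε) * D
            ≤⟨ ≤-by-diff (solve 4 (λ x y E p → ((con 1ℚ :- x) :* E :- p) :- ((con 1ℚ :- y) :* E :- p) := (y :- x) :* E)
                 refl (fromℕ j * τ) (ε * ¼) ((1ℚ - ½ * ε) * D) ((1ℚ - ε) * D))
                 (0≤-* (0≤-diff jτ≤) (0≤-* 0≤1-ε/2 0≤D)) ⟩
          σ * ((1ℚ - ½ * ε) * D) - (1ℚ - ε) * D
            ≤⟨ +-mono-≤ (*-monoˡ-≤ 0≤σ W-lower) (neg-antimono-≤ N*S≤) ⟩
          σ * W - N * S ∎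
          where
          open ≤-Reasoning
          N*S≤ : N * S ≤ (1ℚ - ε) * D
          N*S≤ = ≤-trans (*-monoˡ-≤ 0≤N few-triangles)
            (≤-reflexive (solve 3 (λ N ε G → N :* ((con 1ℚ :- ε) :* G) := (con 1ℚ :- ε) :* (N :* G)) refl N ε (d * d * d)))
          0≤1-ε/2 : 0ℚ ≤ 1ℚ - ½ * ε
          0≤1-ε/2 = 0≤-by (solve 1 (λ e → con 1ℚ :- con ½ :* e := con ½ :* (con 1ℚ :- e) :+ con ½) refl ε)
            (0≤-+ (0≤-* {½} (≤ᵇ⇒≤ _) (0≤-diff ε≤1)) (≤ᵇ⇒≤ _))

        step₁ : (+ 1 / 128) * (ε * ε * ε) * (d * d) ≤ - (c * Z)
        step₁ = begin
          (+ 1 / 128) * (ε * ε * ε) * (d * d)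
            ≡⟨ solve 2 (λ ε d → con (+ 1 / 128) :* (ε :* ε :* ε) :* (d :* d) :=
                 con (+ 1 / 32) :* (ε :* ε) :* (d :* d) :* (ε :* con ¼)) refl ε d ⟩
          (+ 1 / 32) * (ε * ε) * (d * d) * (ε * ¼)
            ≤⟨ *-monoˡ-≤ (0≤-* (0≤-* {+ 1 / 32} (≤ᵇ⇒≤ _) (0≤-square ε)) (0≤-square d)) ≤cτ ⟩
          (+ 1 / 32) * (ε * ε) * (d * d) * (c * (4ℚ * (i * (4ℚ * d * inv ε))))
            ≡⟨ solve 5 (λ ε d c i e →
                 con (+ 1 / 32) :* (ε :* ε) :* (d :* d) :* (c :* (con 4ℚ :* (i :* (con 4ℚ :* d :* e)))) :=
                 con ½ :* c :* (d :* d :* d) :* ε :* i :* (con 1ℚ :* (ε :* e))) refl ε d c i (inv ε) ⟩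
          ½ * c * (d * d * d) * ε * i * (1ℚ * (ε * inv ε))
            ≡⟨ cong₂ (λ x y → ½ * c * (d * d * d) * ε * i * (x * y)) (≡-sym i*N) (*-inv 0<ε) ⟩
          ½ * c * (d * d * d) * ε * i * ((i * N) * 1ℚ)
            ≡⟨ solve 5 (λ ε d3 c i N → con ½ :* c :* d3 :* ε :* i :* ((i :* N) :* con 1ℚ) :=
                 con 2ℚ :* c :* (i :* i) :* (ε :* con ¼ :* (N :* d3))) refl ε (d * d * d) c i N ⟩
          2ℚ * c * r * (ε * ¼ * D)
            ≤⟨ *-monoˡ-≤ (0≤-* (0≤-* {2ℚ} (≤ᵇ⇒≤ _) 0≤c) (0≤-* 0≤i 0≤i)) bracket ⟩
          2ℚ * c * r * (σ * W - N * S)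
            ≡⟨ solve 6 (λ c r σ W N S → con 2ℚ :* c :* r :* (σ :* W :- N :* S) :=
                 :- (c :* (con 2ℚ :* r :* N :* S :+ (:- (con 2ℚ :* r :* σ)) :* W))) refl c r σ W N S ⟩
          - (c * Z) ∎
          where open ≤-Reasoning

      lower-bound : (+ 1 / 128) * (ε * ε * ε) * (d * d) ≤ B
      lower-bound = lower-bound-at (proj₁ j-spec) (proj₁ (proj₂ j-spec)) (proj₂ (proj₂ j-spec))
        where j-spec = multiple-floor τ (ε * ¼) 0<τ (0≤-* {ε} {¼} 0≤ε (≤ᵇ⇒≤ _))

-- Edges, cuts and triangles as rational sums

listSum : ∀ n → (Fin n → ℕ) → ℕ
listSum n f = sum (List.map f (allFin n))

fromℕ-listSum : ∀ {n} (f : Fin n → ℕ) → fromℕ (listSum n f) ≡ ∑ (λ i → fromℕ (f i))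
fromℕ-listSum f = trans (cong (λ xs → fromℕ (sum xs)) (map-tabulate id f)) (sum-tabulate f)
  where
  sum-tabulate : ∀ {n} (f : Fin n → ℕ) → fromℕ (sum (List.tabulate f)) ≡ ∑ (λ i → fromℕ (f i))
  sum-tabulate {zero}  f = trans fromℕ-zero (≡-sym (∑-zero (λ i → fromℕ (f i))))
  sum-tabulate {suc n} f = begin
    fromℕ (f zero ℕ.+ sum (List.tabulate (λ i → f (suc i))))        ≡⟨ fromℕ-+ (f zero) _ ⟩
    fromℕ (f zero) + fromℕ (sum (List.tabulate (λ i → f (suc i))))  ≡⟨ cong (λ s → fromℕ (f zero) + s) (sum-tabulate (λ i → f (suc i))) ⟩
    fromℕ (f zero) + ∑ (λ i → fromℕ (f (suc i)))                    ≡⟨ ∑-suc (λ i → fromℕ (f i)) ⟨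
    ∑ (λ i → fromℕ (f i))                                           ∎
    where open ≡-Reasoning

fromℕ-listSum² : ∀ {n} (f : Fin n → Fin n → ℕ) →
  fromℕ (listSum n λ i → listSum n (f i)) ≡ ∑∑ (λ i j → fromℕ (f i j))
fromℕ-listSum² f = trans (fromℕ-listSum _) (∑-cong λ i → fromℕ-listSum (f i))

lt : ∀ {n} → Fin n → Fin n → ℚ
lt i j = bit (toℕ i ℕ.<ᵇ toℕ j)

0≤lt : ∀ {n} (i j : Fin n) → 0ℚ ≤ lt i j
0≤lt i j = 0≤bit (toℕ i ℕ.<ᵇ toℕ j)

lt≤1 : ∀ {n} (i j : Fin n) → lt i j ≤ 1ℚ
lt≤1 i j with toℕ i ℕ.<ᵇ toℕ j
... | true  = ≤-refl
... | false = ≤ᵇ⇒≤ _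

lt-yes : ∀ {n} {i j : Fin n} → toℕ i ℕ.< toℕ j → lt i j ≡ 1ℚ
lt-yes i<j = cong bit (Equivalence.to T-≡ (ℕP.<⇒<ᵇ i<j))

lt-no : ∀ {n} {i j : Fin n} → ¬ (toℕ i ℕ.< toℕ j) → lt i j ≡ 0ℚ
lt-no {i = i} {j} i≮j with toℕ i ℕ.<ᵇ toℕ j in eq
... | true  = contradiction (ℕP.<ᵇ⇒< (toℕ i) (toℕ j) (Equivalence.from T-≡ eq)) i≮j
... | false = refl

-- The indicator function of Defs is private, so its summands are named by unification.
edge-summand : ∀ {n} (G : Graph n) → Σ (Fin n → Fin n → ℕ) λ f →
  edges G ≡ listSum n λ i → listSum n (f i)
edge-summand G = (λ i j → _) , refl

cut-summand : ∀ {n} (G : Graph n) S → Σ (Fin n → Fin n → ℕ) λ f →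
  cut G S ≡ listSum n λ i → listSum n (f i)
cut-summand G S = (λ i j → _) , refl

triangle-summand : ∀ {n} (G : Graph n) → Σ (Fin n → Fin n → Fin n → ℕ) λ f →
  triangles G ≡ listSum n λ i → listSum n λ j → listSum n (f i j)
triangle-summand G = (λ i j k → _) , refl

module GraphSums {n : ℕ} (G : Graph n) where

  A : Fin n → Fin n → ℚ
  A u v = bit (adj G u v)

  A-sym : ∀ u v → A u v ≡ A v u
  A-sym u v = cong bit (sym G u v)

  A-diag : ∀ u → A u u ≡ 0ℚ
  A-diag u = cong bit (irrefl G u)

  edges-as-sum : fromℕ (edges G) ≡ ∑∑ λ i j → lt i j * A i j
  edges-as-sum = trans (fromℕ-listSum² (proj₁ (edge-summand G))) (∑∑-cong pointwise)
    where
    pointwise : ∀ i j → fromℕ (proj₁ (edge-summand G) i j) ≡ lt i j * A i j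
    pointwise i j with toℕ i ℕ.<ᵇ toℕ j | adj G i j
    ... | true  | true  = fromℕ-one
    ... | true  | false = fromℕ-zero
    ... | false | true  = fromℕ-zero
    ... | false | false = fromℕ-zero

  crossing : Partition n → Fin n → Fin n → ℚ
  crossing S i j = bit (lookup S i xor lookup S j)

  cut-as-sum : ∀ S → fromℕ (cut G S) ≡ ∑∑ λ i j → lt i j * (A i j * crossing S i j)
  cut-as-sum S = trans (fromℕ-listSum² (proj₁ (cut-summand G S))) (∑∑-cong pointwise)
    where
    pointwise : ∀ i j → fromℕ (proj₁ (cut-summand G S) i j) ≡ lt i j * (A i j * crossing S i j)
    pointwise i j with toℕ i ℕ.<ᵇ toℕ j | adj G i j | lookup S i xor lookup S j
    ... | true  | true  | true  = fromℕ-one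
    ... | true  | true  | false = fromℕ-zero
    ... | true  | false | true  = fromℕ-zero
    ... | true  | false | false = fromℕ-zero
    ... | false | true  | true  = fromℕ-zero
    ... | false | true  | false = fromℕ-zero
    ... | false | false | true  = fromℕ-zero
    ... | false | false | false = fromℕ-zero

  triple : Fin n → Fin n → Fin n → ℚ
  triple i j k = A i j * (A i k * A j k)

  triangles-as-sum : fromℕ (triangles G) ≡ ∑ λ i → ∑∑ λ j k → lt i j * lt j k * triple i j k
  triangles-as-sum = trans (fromℕ-listSum _)
    (∑-cong λ i → trans (fromℕ-listSum² (proj₁ (triangle-summand G) i)) (∑∑-cong (pointwise i)))
    where
    pointwise : ∀ i j k → fromℕ (proj₁ (triangle-summand G) i j k) ≡ lt i j * lt j k * triple i j k
    pointwise i j k with toℕ i ℕ.<ᵇ toℕ j | toℕ j ℕ.<ᵇ toℕ k | adj G i j | adj G j k | adj G i k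
    ... | true  | true  | true  | true  | true  = fromℕ-one
    ... | true  | true  | true  | true  | false = fromℕ-zero
    ... | true  | true  | true  | false | true  = fromℕ-zero
    ... | true  | true  | true  | false | false = fromℕ-zero
    ... | true  | true  | false | b     | c     = trans fromℕ-zero (solve 1 (λ x → con 0ℚ := con 1ℚ :* con 1ℚ :* (con 0ℚ :* x)) refl (bit c * bit b))
    ... | true  | false | a     | b     | c     = trans fromℕ-zero (solve 1 (λ x → con 0ℚ := con 1ℚ :* con 0ℚ :* x) refl (bit a * (bit c * bit b)))
    ... | false | o     | a     | b     | c     = trans fromℕ-zero (solve 2 (λ y x → con 0ℚ := con 0ℚ :* y :* x) refl (bit o) (bit a * (bit c * bit b)))

  ordered : (Fin n → Fin n → ℚ) → ℚ
  ordered f = ∑∑ λ i j → lt i j * f i j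

  symmetric-sum : (f : Fin n → Fin n → ℚ) → (∀ i j → f i j ≡ f j i) → (∀ i → f i i ≡ 0ℚ) →
                  ∑∑ f ≡ ordered f + ordered f
  symmetric-sum f f-sym f-diag = begin
    ∑∑ f                                            ≡⟨ ∑∑-cong split ⟩
    ∑∑ (λ i j → lt i j * f i j + lt j i * f j i)    ≡⟨ ∑∑-+ (λ i j → lt i j * f i j) (λ i j → lt j i * f j i) ⟩
    ordered f + ∑∑ (λ i j → lt j i * f j i)         ≡⟨ cong (λ s → ordered f + s) (∑-comm λ i j → lt j i * f j i) ⟩
    ordered f + ordered f                           ∎
    where
    open ≡-Reasoning
    split : ∀ i j → f i j ≡ lt i j * f i j + lt j i * f j i
    split i j with FinP.<-cmp i j
    ... | tri< i<j _ j≮i = trans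
      (solve 2 (λ p q → p := con 1ℚ :* p :+ con 0ℚ :* q) refl (f i j) (f j i))
      (cong₂ (λ p q → p * f i j + q * f j i) (≡-sym (lt-yes i<j)) (≡-sym (lt-no j≮i)))
    ... | tri≈ _ refl _ rewrite f-diag i =
      solve 1 (λ p → con 0ℚ := p :* con 0ℚ :+ p :* con 0ℚ) refl (lt i i)
    ... | tri> i≮j _ j<i = trans (trans (f-sym i j)
      (solve 2 (λ p q → q := con 0ℚ :* p :+ con 1ℚ :* q) refl (f i j) (f j i)))
      (cong₂ (λ p q → p * f i j + q * f j i) (≡-sym (lt-no i≮j)) (≡-sym (lt-yes j<i)))

  twice-edges : ∑∑ A ≡ fromℕ (edges G) + fromℕ (edges G)
  twice-edges = trans (symmetric-sum A A-sym A-diag) (≡-sym (cong₂ _+_ edges-as-sum edges-as-sum))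

  twice-cut : ∀ S → ∑∑ (λ i j → A i j * crossing S i j) ≡ fromℕ (cut G S) + fromℕ (cut G S)
  twice-cut S = trans
    (symmetric-sum (λ i j → A i j * crossing S i j)
      (λ i j → cong₂ _*_ (A-sym i j) (cong bit (xor-comm (lookup S i) (lookup S j))))
      (λ i → trans (cong (_* crossing S i i) (A-diag i)) (*-zeroˡ (crossing S i i))))
    (≡-sym (cong₂ _+_ (cut-as-sum S) (cut-as-sum S)))

  -- A product of signs is 1 on an uncut edge and - 1 on a cut one, and `quad` sees each edge twice.
  -- The value is 2e - 4 cut, which explains why four times the surplus is the natural quantity.
  quad-signs : ∀ (S : Fin n → Bool) → let c = fromℕ (cut G (Vec.tabulate S)) in
    quad A (λ u → sign (S u)) ≡ (fromℕ (edges G) + fromℕ (edges G)) + (- 2ℚ) * (c + c)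
  quad-signs S = begin
    quad A (λ u → sign (S u))
      ≡⟨ ∑∑-cong (λ u v → trans (cong (A u v *_) (sign-product u v)) (≡-sym (expand (A u v) (crossing V u v)))) ⟩
    ∑∑ (λ u v → 1ℚ * A u v + (- 2ℚ) * (A u v * crossing V u v))
      ≡⟨ ∑∑-linear 1ℚ (- 2ℚ) A (λ u v → A u v * crossing V u v) ⟩
    1ℚ * ∑∑ A + (- 2ℚ) * ∑∑ (λ u v → A u v * crossing V u v)
      ≡⟨ cong₂ (λ p q → p + (- 2ℚ) * q) (trans (*-identityˡ (∑∑ A)) twice-edges) (twice-cut V) ⟩
    (fromℕ (edges G) + fromℕ (edges G)) + (- 2ℚ) * (fromℕ (cut G V) + fromℕ (cut G V)) ∎
    where
    open ≡-Reasoning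
    V = Vec.tabulate S
    expand : ∀ a x → 1ℚ * a + (- 2ℚ) * (a * x) ≡ a * (1ℚ + (- 2ℚ) * x)
    expand = solve 2 (λ a x → con 1ℚ :* a :+ con (- 2ℚ) :* (a :* x) := a :* (con 1ℚ :+ con (- 2ℚ) :* x)) refl
    sign-xor : ∀ a b → sign a * sign b ≡ 1ℚ + (- 2ℚ) * bit (a xor b)
    sign-xor true  true  = refl
    sign-xor true  false = refl
    sign-xor false true  = refl
    sign-xor false false = refl
    sign-product : ∀ u v → sign (S u) * sign (S v) ≡ 1ℚ + (- 2ℚ) * crossing V u v
    sign-product u v = trans (sign-xor (S u) (S v))
      (cong₂ (λ a b → 1ℚ + (- 2ℚ) * bit (a xor b)) (≡-sym (lookup∘tabulate S u)) (≡-sym (lookup∘tabulate S v)))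

  cut≤mc : ∀ S → cut G S ℕ.≤ mc G
  cut≤mc S = ≤-foldr-⊔ (∈-map⁺ (cut G) (∈-allPartitions S))
    where
    ≤-foldr-⊔ : ∀ {x xs} → x ∈ xs → x ℕ.≤ foldr ℕ._⊔_ 0 xs
    ≤-foldr-⊔ {xs = y ∷ ys} (here refl) = ℕP.m≤m⊔n y _
    ≤-foldr-⊔ {xs = y ∷ ys} (there x∈)  = ℕP.≤-trans (≤-foldr-⊔ x∈) (ℕP.m≤n⊔m y _)
    ∈-allPartitions : ∀ {m} (S : Partition m) → S ∈ allPartitions m
    ∈-allPartitions Vec.[] = here refl
    ∈-allPartitions {suc m} (b Vec.∷ S) =
      ∈-concatMap⁺ (λ v → (true Vec.∷ v) ∷ (false Vec.∷ v) ∷ []) {xs = allPartitions m} (Any.map (extends b) (∈-allPartitions S))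
      where
      extends : ∀ b {v} → S ≡ v → (b Vec.∷ S) ∈ ((true Vec.∷ v) ∷ (false Vec.∷ v) ∷ [])
      extends true  refl = here refl
      extends false refl = there (here refl)

  quadruple-surplus : ℚ
  quadruple-surplus = 4ℚ * fromℕ (mc G) - 2ℚ * fromℕ (edges G)

  surplus-on-cube : ∀ x → InBox x → 0ℚ ≤ quadruple-surplus + quad A x
  surplus-on-cube = cube-from-vertices A A-diag quadruple-surplus λ S →
    0≤-by (trans (cong (λ q → quadruple-surplus + q) (quad-signs S))
      (solve 3 (λ m e c → (con 4ℚ :* m :- con 2ℚ :* e) :+ ((e :+ e) :+ con (- 2ℚ) :* (c :+ c)) := con 4ℚ :* (m :- c))
        refl (fromℕ (mc G)) (fromℕ (edges G)) (fromℕ (cut G (Vec.tabulate S)))))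
      (0≤-* {4ℚ} (≤ᵇ⇒≤ _) (0≤-diff (fromℕ-mono (cut≤mc (Vec.tabulate S)))))

  -- Triangles and closed walks of length three

  0≤triple : ∀ i j k → 0ℚ ≤ triple i j k
  0≤triple i j k = 0≤-* (0≤bit (adj G i j)) (0≤-* (0≤bit (adj G i k)) (0≤bit (adj G j k)))

  triple-swap₁₂ : ∀ i j k → triple j i k ≡ triple i j k
  triple-swap₁₂ i j k = trans (cong (_* (A j k * A i k)) (A-sym j i))
    (solve 3 (λ p q r → p :* (q :* r) := p :* (r :* q)) refl (A i j) (A j k) (A i k))

  triple-swap₂₃ : ∀ i j k → triple i k j ≡ triple i j k
  triple-swap₂₃ i j k = trans (cong (λ a → A i k * (A i j * a)) (A-sym k j))
    (solve 3 (λ p q r → p :* (q :* r) := q :* (p :* r)) refl (A i k) (A i j) (A j k))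

  triple-diag₁₂ : ∀ i k → triple i i k ≡ 0ℚ
  triple-diag₁₂ i k = trans (cong (_* (A i k * A i k)) (A-diag i)) (*-zeroˡ (A i k * A i k))

  triple-diag₂₃ : ∀ i j → triple i j j ≡ 0ℚ
  triple-diag₂₃ i j = trans (cong (λ a → A i j * (A i j * a)) (A-diag j))
    (solve 1 (λ a → a :* (a :* con 0ℚ) := con 0ℚ) refl (A i j))

  triple-diag₁₃ : ∀ i j → triple i j i ≡ 0ℚ
  triple-diag₁₃ i j = trans (triple-swap₂₃ i i j) (triple-diag₁₂ i j)

  increasing : Fin n → Fin n → Fin n → ℚ
  increasing i j k = lt i j * lt j k * triple i j k

  0≤increasing : ∀ i j k → 0ℚ ≤ increasing i j k
  0≤increasing i j k = 0≤-* (0≤-* (0≤lt i j) (0≤lt j k)) (0≤triple i j k)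

  -- For j < k in a triangle i j k, the vertex i comes before, between or after them.
  insert-position : ∀ i j k → lt j k * triple i j k ≤ increasing i j k + (increasing j i k + increasing j k i)
  insert-position i j k with FinP.<-cmp i j
  ... | tri≈ _ refl _ = subst (_≤ increasing i i k + (increasing i i k + increasing i k i))
          (≡-sym (trans (cong (lt i k *_) (triple-diag₁₂ i k)) (*-zeroʳ (lt i k))))
          (0≤-+ (0≤increasing i i k) (0≤-+ (0≤increasing i i k) (0≤increasing i k i)))
  ... | tri< i<j _ _ = ≤-by-diff
          (trans (cong (λ l → l * lt j k * triple i j k + (increasing j i k + increasing j k i) - lt j k * triple i j k) (lt-yes i<j))
            (solve 3 (λ l t r → con 1ℚ :* l :* t :+ r :- l :* t := r) refl (lt j k) (triple i j k) (increasing j i k + increasing j k i)))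
          (0≤-+ (0≤increasing j i k) (0≤increasing j k i))
  ... | tri> _ _ j<i with FinP.<-cmp i k
  ...   | tri≈ _ refl _ = subst (_≤ increasing i j i + (increasing j i i + increasing j i i))
          (≡-sym (trans (cong (lt j i *_) (triple-diag₁₃ i j)) (*-zeroʳ (lt j i))))
          (0≤-+ (0≤increasing i j i) (0≤-+ (0≤increasing j i i) (0≤increasing j i i)))
  ...   | tri< i<k _ _ = ≤-by-diff
          (trans (cong₂ (λ l t → increasing i j k + (l * t + increasing j k i) - lt j k * triple i j k)
                   (cong₂ _*_ (lt-yes j<i) (lt-yes i<k)) (triple-swap₁₂ i j k))
            (solve 4 (λ p r l t → p :+ (con 1ℚ :* con 1ℚ :* t :+ r) :- l :* t := p :+ (r :+ (con 1ℚ :- l) :* t))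
              refl (increasing i j k) (increasing j k i) (lt j k) (triple i j k)))
          (0≤-+ (0≤increasing i j k) (0≤-+ (0≤increasing j k i) (0≤-* (0≤-diff (lt≤1 j k)) (0≤triple i j k))))
  ...   | tri> _ _ k<i = ≤-by-diff
          (trans (cong₂ (λ l t → increasing i j k + (increasing j i k + lt j k * l * t) - lt j k * triple i j k)
                   (lt-yes k<i) (trans (triple-swap₂₃ j i k) (triple-swap₁₂ i j k)))
            (solve 4 (λ p r l t → p :+ (r :+ l :* con 1ℚ :* t) :- l :* t := p :+ r)
              refl (increasing i j k) (increasing j i k) (lt j k) (triple i j k)))
          (0≤-+ (0≤increasing i j k) (0≤increasing j i k))

  -- The factor 6 arises as 2 · 3: symmetry in the last two vertices reduces to increasing order
  -- there, and `insert-position` distributes the rest over the three places of the first vertex.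
  closed-walks≤ : ∑∑ (λ u v → A u v * ∑ λ s → A u s * A v s) ≤ + 6 / 1 * fromℕ (triangles G)
  closed-walks≤ = begin
    ∑∑ (λ u v → A u v * ∑ λ s → A u s * A v s)
      ≡⟨ ∑∑-cong (λ u v → ∑-*ˡ (A u v) (λ s → A u s * A v s)) ⟨
    ∑ (λ u → ∑∑ (triple u))
      ≡⟨ ∑-cong (λ u → symmetric-sum (triple u) (λ v s → ≡-sym (triple-swap₂₃ u v s)) (triple-diag₂₃ u)) ⟩
    ∑ (λ u → ordered (triple u) + ordered (triple u))
      ≡⟨ ∑-+ (λ u → ordered (triple u)) (λ u → ordered (triple u)) ⟩
    ∑ (λ u → ordered (triple u)) + ∑ (λ u → ordered (triple u))
      ≤⟨ +-mono-≤ half half ⟩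
    (T + (T + T)) + (T + (T + T))
      ≡⟨ solve 1 (λ t → (t :+ (t :+ t)) :+ (t :+ (t :+ t)) := con (+ 6 / 1) :* t) refl T ⟩
    + 6 / 1 * T ∎
    where
    open ≤-Reasoning
    T = fromℕ (triangles G)
    half : ∑ (λ u → ordered (triple u)) ≤ T + (T + T)
    half = begin
      ∑ (λ u → ∑∑ λ v s → lt v s * triple u v s)
        ≤⟨ ∑-mono (λ u → ∑∑-mono (insert-position u)) ⟩
      ∑ (λ u → ∑∑ λ v s → increasing u v s + (increasing v u s + increasing v s u))
        ≡⟨ ∑-cong (λ u → trans (∑∑-+ (increasing u) (λ v s → increasing v u s + increasing v s u))
             (cong (λ q → ∑∑ (increasing u) + q) (∑∑-+ (λ v s → increasing v u s) (λ v s → increasing v s u)))) ⟩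
      ∑ (λ u → ∑∑ (increasing u) + (∑∑ (λ v s → increasing v u s) + ∑∑ (λ v s → increasing v s u)))
        ≡⟨ trans (∑-+ (λ u → ∑∑ (increasing u)) (λ u → ∑∑ (λ v s → increasing v u s) + ∑∑ (λ v s → increasing v s u)))
             (cong (λ q → ∑ (λ u → ∑∑ (increasing u)) + q)
                (∑-+ (λ u → ∑∑ (λ v s → increasing v u s)) (λ u → ∑∑ (λ v s → increasing v s u)))) ⟩
      ∑ (λ u → ∑∑ (increasing u)) +
      (∑ (λ u → ∑∑ λ v s → increasing v u s) + ∑ (λ u → ∑∑ λ v s → increasing v s u))
        ≡⟨ cong₂ _+_ (≡-sym triangles-as-sum) (cong₂ _+_ second third) ⟩
      T + (T + T) ∎
      where
      second : ∑ (λ u → ∑∑ λ v s → increasing v u s) ≡ T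
      second = trans (∑-comm λ u v → ∑ λ s → increasing v u s) (≡-sym triangles-as-sum)
      third : ∑ (λ u → ∑∑ λ v s → increasing v s u) ≡ T
      third = trans (∑-comm λ u v → ∑ λ s → increasing v s u)
        (trans (∑-cong λ v → ∑-comm λ u s → increasing v s u) (≡-sym triangles-as-sum))

-- Average degree, nondegeneracy and the final constant

quadruple-surplus≡4sp : ∀ {n} (G : Graph n) → GraphSums.quadruple-surplus G ≡ 4ℚ * sp G
quadruple-surplus≡4sp G = begin
  4ℚ * fromℕ (mc G) - 2ℚ * fromℕ (edges G)     ≡⟨ cong₂ (λ m e → 4ℚ * m - 2ℚ * e) (≡-sym (fromℕ-def (mc G))) (trans (cong (h *_) (≡-sym (fromℕ-def 2))) (/-*-cancel (edges G) 2)) ⟨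
  4ℚ * m - 2ℚ * (h * 2ℚ)            ≡⟨ solve 2 (λ m h → con 4ℚ :* m :- con 2ℚ :* (h :* con 2ℚ) := con 4ℚ :* (m :- h)) refl m h ⟩
  4ℚ * (m - h)                      ∎
  where
  open ≡-Reasoning
  m = + mc G / 1
  h = + edges G / 2

avgDeg-nonNeg : ∀ {n} .{{_ : NonZero n}} (G : Graph n) → 0ℚ ≤ avgDeg G
avgDeg-nonNeg {n} G = nonNegative⁻¹ (avgDeg G) {{normalize-nonNeg (2 ℕ.* edges G) n}}

degree-sum : ∀ {n} .{{_ : NonZero n}} (G : Graph n) → fromℕ n * avgDeg G ≡ ∑∑ (GraphSums.A G)
degree-sum {n} G = begin
  fromℕ n * avgDeg G                           ≡⟨ *-comm (fromℕ n) (avgDeg G) ⟩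
  avgDeg G * fromℕ n                           ≡⟨ /-*-cancel (2 ℕ.* edges G) n ⟩
  fromℕ (2 ℕ.* edges G)                        ≡⟨ cong (λ k → fromℕ (edges G ℕ.+ k)) (ℕP.+-identityʳ (edges G)) ⟩
  fromℕ (edges G ℕ.+ edges G)                  ≡⟨ fromℕ-+ (edges G) (edges G) ⟩
  fromℕ (edges G) + fromℕ (edges G)            ≡⟨ GraphSums.twice-edges G ⟨
  ∑∑ (GraphSums.A G)                           ∎
  where open ≡-Reasoning

-- A nonnegative count lies strictly below the right side, which is therefore positive; that rules
-- out d = 0, and also ε > 1.
nondegenerate : ∀ {ε d t} → 0ℚ ≤ d → 0ℚ ≤ t → t < (1ℚ - ε) * (d * d * d) * (+ 1 / 6) →
                (0ℚ < d) × (ε ≤ 1ℚ)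
nondegenerate {ε} {d} {t} 0≤d 0≤t few = 0<d , ε≤1
  where
  0<rhs : 0ℚ < (1ℚ - ε) * (d * d * d) * (+ 1 / 6)
  0<rhs = ≤-<-trans 0≤t few

  0<d : 0ℚ < d
  0<d with 0≤⇒≡0⊎0< 0≤d
  ... | inj₂ 0<d = 0<d
  ... | inj₁ d≡0 = contradiction
    (trans (solve 1 (λ e → con 0ℚ := (con 1ℚ :- e) :* (con 0ℚ :* con 0ℚ :* con 0ℚ) :* con (+ 1 / 6)) refl ε)
           (cong (λ x → (1ℚ - ε) * (x * x * x) * (+ 1 / 6)) (≡-sym d≡0)))
    (<⇒≢ 0<rhs)

  ε≤1 : ε ≤ 1ℚ
  ε≤1 with ≤-total ε 1ℚ
  ... | inj₁ ε≤1 = ε≤1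
  ... | inj₂ 1≤ε = contradiction
    (≤-by-diff (solve 2 (λ e x → con 0ℚ :- (con 1ℚ :- e) :* x :* con (+ 1 / 6) := (e :- con 1ℚ) :* x :* con (+ 1 / 6)) refl ε (d * d * d))
               (0≤-* (0≤-* (0≤-diff 1≤ε) (0≤-* (0≤-* 0≤d 0≤d) 0≤d)) (≤ᵇ⇒≤ _)))
    (λ rhs≤0 → <-irrefl refl (<-≤-trans 0<rhs rhs≤0))

-- The average degree enters as a variable `d` tied to the graph only by the handshake identity, so
-- that no fraction 2e/n appears in the estimates.
quadruple-surplus-lower : ∀ {n} .{{_ : NonZero n}} (G : Graph n) ε d → 0ℚ < ε → 0ℚ ≤ d →
  fromℕ n * d ≡ ∑∑ (GraphSums.A G) →
  fromℕ (triangles G) < (1ℚ - ε) * (d * d * d) * (+ 1 / 6) →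
  (+ 1 / 128) * (ε * ε * ε) * (d * d) ≤ GraphSums.quadruple-surplus G
quadruple-surplus-lower {n} G ε d 0<ε 0≤d n*d few =
  lower-bound n*d quadruple-surplus surplus-on-cube S≤
  where
  open GraphSums G using (quadruple-surplus; surplus-on-cube; closed-walks≤)
  0<d×ε≤1 = nondegenerate 0≤d (fromℕ-nonNeg (triangles G)) few
  open SurplusBound n (adj G) (sym G) ε 0<ε (proj₂ 0<d×ε≤1) d (proj₁ 0<d×ε≤1)
  open ≤-Reasoning

  S≤ : S ≤ (1ℚ - ε) * (d * d * d)
  S≤ = begin
    S                                                    ≤⟨ closed-walks≤ ⟩
    + 6 / 1 * fromℕ (triangles G)                        ≤⟨ *-monoˡ-≤ {+ 6 / 1} (≤ᵇ⇒≤ _) (<⇒≤ few) ⟩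
    + 6 / 1 * ((1ℚ - ε) * (d * d * d) * (+ 1 / 6))       ≡⟨ solve 1 (λ x → con (+ 6 / 1) :* (x :* con (+ 1 / 6)) := x) refl ((1ℚ - ε) * (d * d * d)) ⟩
    (1ℚ - ε) * (d * d * d)                               ∎

rescale : ∀ ε d s {q} → q ≡ 4ℚ * s → (+ 1 / 128) * (ε * ε * ε) * (d * d) ≤ q →
          (+ 1 / 512) * (ε * ε * ε) * (d * d) ≤ s
rescale ε d s {q} q≡4s bound = begin
  (+ 1 / 512) * (ε * ε * ε) * (d * d)
    ≡⟨ solve 2 (λ x y → con (+ 1 / 512) :* x :* y := con ¼ :* (con (+ 1 / 128) :* x :* y)) refl (ε * ε * ε) (d * d) ⟩
  ¼ * ((+ 1 / 128) * (ε * ε * ε) * (d * d))    ≤⟨ *-monoˡ-≤ {¼} (≤ᵇ⇒≤ _) bound ⟩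
  ¼ * q                                        ≡⟨ cong (¼ *_) q≡4s ⟩
  ¼ * (4ℚ * s)                                 ≡⟨ solve 1 (λ s → con ¼ :* (con 4ℚ :* s) := s) refl s ⟩
  s                                            ∎
  where open ≤-Reasoning

theorem1p2 : (ε : ℚ) → 0ℚ < ε →
    Σ ℚ (λ c → 0ℚ < c ×
    ((n : ℕ) → .{{_ : NonZero n}} → (G : Graph n) →
    (+ triangles G / 1) < (1ℚ - ε) * (avgDeg G * avgDeg G * avgDeg G) * (+ 1 / 6) →
    c * (avgDeg G * avgDeg G) ≤ sp G))
theorem1p2 ε 0<ε =
  -- The bound ε³/128 is for four times the surplus; hence 512 = 4 · 128.
  (+ 1 / 512) * (ε * ε * ε) ,
  0<-* {+ 1 / 512} (positive⁻¹ (+ 1 / 512)) (0<-* (0<-* 0<ε 0<ε) 0<ε) ,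
  λ n G few → rescale ε (avgDeg G) (sp G) (quadruple-surplus≡4sp G)
    (quadruple-surplus-lower G ε (avgDeg G) 0<ε (avgDeg-nonNeg G) (degree-sum G)
      (subst (_< (1ℚ - ε) * (avgDeg G * avgDeg G * avgDeg G) * (+ 1 / 6)) (≡-sym (fromℕ-def (triangles G))) few))
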